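{- Let $G$ be a connected graph. If every optimal vector coloring of $G$ is locally injective, then $G$ is a core; likewise, if every optimal strict vector coloring of $G$ is locally injective, then $G$ is a core. In particular, if $G$ is uniquely vector colorable and its unique optimal vector coloring is locally injective, then $G$ is a core.
   Context: A vector $t$-coloring of $G$ ($t\ge2$) assigns unit vectors $p_i\in\mathbb{R}^d$ to vertices with $\langle p_i,p_j\rangle\le-1/(t-1)$ for all edges $ij$; it is strict if equality holds on all edges. $\chi_v(G)$ (resp. $\chi_{sv}(G)$) is the least $t\ge2$ admitting a (resp. strict) vector $t$-coloring; an optimal (strict) vector coloring is a (strict) vector $\chi_v(G)$- (resp. $\chi_{sv}(G)$-) coloring. $G$ is uniquely vector colorable if any two optimal vector colorings have the same Gram matrix. A vector coloring is locally injective if no two distinct vertices having a common neighbor are assigned the same vector. A graph homomorphism $G\to H$ is an adjacency-preserving map $V(G)\to V(H)$; $G$ is a core if every homomorphism $G\to G$ is an automorphism (equivalently, $G$ has no homomorphism to a proper subgraph). -}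

module Defs where

open import Level using (0ℓ)
open import Algebra.Bundles using (CommutativeRing)
open import Algebra.Structures using (IsCommutativeRing)
open import Data.Fin.Base using (Fin)
open import Data.Nat.Base using (ℕ)
open import Data.Product.Base using (Σ-syntax; ∃-syntax; _×_)
open import Data.Vec.Functional using (Vector)
open import Function.Definitions using (Bijective)
open import Relation.Binary.Construct.Closure.ReflexiveTransitive using (Star)
open import Relation.Binary.Core using (Rel; _Preserves_⟶_)
open import Relation.Binary.Definitions using (Irreflexive; Symmetric)
open import Relation.Binary.PropositionalEquality.Core using (_≡_)
open import Relation.Binary.Structures using (IsTotalOrder)
open import Relation.Nullary.Negation.Core using (¬_)
open import Relation.Unary using (Pred; _∈_)

import Algebra.Properties.Monoid.Sum as MonoidSum

-- The standard library has no real numbers.  They are axiomatised as a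
-- Dedekind-complete totally ordered field; classically this determines ℝ up to
-- unique isomorphism.  Equality is a setoid equality.
record CompleteOrderedField : Set₁ where
  infix  8 _⁻¹
  infix  8 -_
  infixl 7 _*_
  infixl 6 _+_ _-_
  infix  4 _≈_ _≤_
  field
    Carrier : Set
    _≈_     : Rel Carrier 0ℓ
    _≤_     : Rel Carrier 0ℓ
    _+_     : Carrier → Carrier → Carrier
    _*_     : Carrier → Carrier → Carrier
    -_      : Carrier → Carrier
    0#      : Carrier
    1#      : Carrier
    -- Total, with an unspecified value at 0#.
    _⁻¹     : Carrier → Carrier

    isCommutativeRing : IsCommutativeRing _≈_ _+_ _*_ -_ 0# 1#
    0≉1               : ¬ (0# ≈ 1#)
    ⁻¹-inverseʳ       : ∀ x → ¬ (x ≈ 0#) → x * x ⁻¹ ≈ 1#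

    isTotalOrder : IsTotalOrder _≈_ _≤_
    +-monoˡ-≤    : ∀ {x y} z → x ≤ y → x + z ≤ y + z
    *-nonNeg     : ∀ {x y} → 0# ≤ x → 0# ≤ y → 0# ≤ x * y

  UpperBound : Pred Carrier 0ℓ → Carrier → Set
  UpperBound S b = ∀ x → x ∈ S → x ≤ b

  field
    supremum : (S : Pred Carrier 0ℓ) →
               ∃[ x ] x ∈ S →
               ∃[ b ] UpperBound S b →
               ∃[ s ] (UpperBound S s × (∀ b → UpperBound S b → s ≤ b))

  commutativeRing : CommutativeRing 0ℓ 0ℓ
  commutativeRing = record { isCommutativeRing = isCommutativeRing }

  open CommutativeRing commutativeRing public using (+-monoid)

  _-_ : Carrier → Carrier → Carrier
  x - y = x + (- y)

  2# : Carrier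
  2# = 1# + 1#

record SimpleGraph (n : ℕ) : Set₁ where
  field
    Adj       : Rel (Fin n) 0ℓ
    symmetric : Symmetric Adj
    loopless  : Irreflexive _≡_ Adj

module _ {n : ℕ} (G : SimpleGraph n) where
  open SimpleGraph G

  Connected : Set
  Connected = ∀ i j → Star Adj i j

  IsEndomorphism : (Fin n → Fin n) → Set
  IsEndomorphism f = f Preserves Adj ⟶ Adj

  IsAutomorphism : (Fin n → Fin n) → Set
  IsAutomorphism f =
    IsEndomorphism f × Bijective _≡_ _≡_ f × (∀ {i j} → Adj (f i) (f j) → Adj i j)

  IsCore : Set
  IsCore = ∀ f → IsEndomorphism f → IsAutomorphism f

module _ (ℝ : CompleteOrderedField) where
  open CompleteOrderedField ℝ
  open MonoidSum +-monoid using (sum)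

  ⟨_,_⟩ : ∀ {d} → Vector Carrier d → Vector Carrier d → Carrier
  ⟨ u , v ⟩ = sum (λ k → u k * v k)

  SameVector : ∀ {d} → Vector Carrier d → Vector Carrier d → Set
  SameVector u v = ∀ k → u k ≈ v k

  IsLeast : Pred Carrier 0ℓ → Carrier → Set
  IsLeast P t = t ∈ P × (∀ s → s ∈ P → t ≤ s)

  module _ {n : ℕ} (G : SimpleGraph n) where
    open SimpleGraph G

    Assignment : ℕ → Set
    Assignment d = Fin n → Vector Carrier d

    record IsVectorColoring (t : Carrier) {d : ℕ} (p : Assignment d) : Set where
      field
        2≤t  : 2# ≤ t
        unit : ∀ i → ⟨ p i , p i ⟩ ≈ 1#
        edge : ∀ {i j} → Adj i j → ⟨ p i , p j ⟩ ≤ - ((t - 1#) ⁻¹)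

    record IsStrictVectorColoring (t : Carrier) {d : ℕ} (p : Assignment d) : Set where
      field
        isVectorColoring : IsVectorColoring t p
        strict           : ∀ {i j} → Adj i j → ⟨ p i , p j ⟩ ≈ - ((t - 1#) ⁻¹)

    IsVectorChromaticNumber : Carrier → Set
    IsVectorChromaticNumber =
      IsLeast (λ t → Σ[ d ∈ ℕ ] Σ[ p ∈ Assignment d ] IsVectorColoring t p)

    IsStrictVectorChromaticNumber : Carrier → Set
    IsStrictVectorChromaticNumber =
      IsLeast (λ t → Σ[ d ∈ ℕ ] Σ[ p ∈ Assignment d ] IsStrictVectorColoring t p)

    IsOptimalVectorColoring : ∀ {d} → Assignment d → Set
    IsOptimalVectorColoring p =
      ∃[ t ] (IsVectorChromaticNumber t × IsVectorColoring t p)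

    IsOptimalStrictVectorColoring : ∀ {d} → Assignment d → Set
    IsOptimalStrictVectorColoring p =
      ∃[ t ] (IsStrictVectorChromaticNumber t × IsStrictVectorColoring t p)

    -- The two colorings may live in spaces of different dimensions.
    UniquelyVectorColorable : Set
    UniquelyVectorColorable =
      ∀ {d e} (p : Assignment d) (q : Assignment e) →
      IsOptimalVectorColoring p → IsOptimalVectorColoring q →
      ∀ i j → ⟨ p i , p j ⟩ ≈ ⟨ q i , q j ⟩

    LocallyInjective : ∀ {d} → Assignment d → Set
    LocallyInjective p =
      ∀ i j k → ¬ (i ≡ j) → Adj i k → Adj j k → ¬ SameVector (p i) (p j)

module Submission where

-- If p is a vector coloring and f an endomorphism, then p ∘ f is a vector
-- coloring with the same parameter, so optimality is preserved.  Some iterate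
-- r of f is idempotent; if p ∘ r is locally injective, then so is r, and a locally
-- injective retraction of a connected graph is the identity, which makes f
-- an automorphism.  In the uniquely colorable case p ∘ r inherits local
-- injectivity from p, because equality of vectors is visible in the Gram matrix.
--
-- Without an optimal coloring the hypotheses of the first two claims would hold
-- vacuously, but one always exists: in terms of τ = 1 / (t - 1) and the Gram
-- matrix, the colorings with τ bounded below by a positive constant form a closed
-- bounded set (dimension plays no role, since every positive semidefinite n × n
-- matrix is the Gram matrix of n vectors in dimension n), and τ attains its
-- maximum on it.  The set is nonempty because small negative off-diagonal entries
-- keep the matrix positive semidefinite.

open import Level using (0ℓ)
open import Algebra.Bundles using (CommutativeRing)
open import Axiom.ExcludedMiddle using (ExcludedMiddle)
open import Data.Empty using (⊥-elim)
open import Data.Fin.Base using (Fin; zero; suc; combine; finToFun; funToFin; remQuot; toℕ)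
open import Data.Fin.Properties as Fin using (combine-remQuot; finToFun-funToFin; pigeonhole; remQuot-combine)
open import Data.Integer.Base as ℤ using (ℤ; +_; -[1+_]; _⊖_)
open import Data.Maybe.Base using (Maybe; just; nothing)
open import Data.Nat.Base as ℕ using (ℕ; zero; suc; _∸_)
open import Data.Nat.GeneralisedArithmetic using (fold; fold-+)
open import Data.Product.Base using (Σ-syntax; ∃; ∃-syntax; _×_; _,_; proj₁; proj₂; uncurry)
open import Data.Sum.Base using (inj₁; inj₂)
open import Data.Vec.Functional using (Vector; _∷_)
open import Function.Base using (_∘_; const; id)
open import Relation.Binary.Bundles using (Poset)
open import Relation.Binary.Construct.Closure.ReflexiveTransitive as Star using (Star; _◅_)
open import Relation.Binary.PropositionalEquality as ≡ using (_≡_)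
open import Relation.Binary.Structures using (IsTotalOrder)
open import Relation.Nullary using (¬_; yes; no)
open import Relation.Nullary.Decidable using (decidable-stable)
open import Defs

import Algebra.Properties.Monoid.Sum
import Algebra.Properties.Ring
import Algebra.Properties.Semiring.Mult.TCOptimised
import Algebra.Solver.Ring
import Algebra.Solver.Ring.AlmostCommutativeRing as ACR
import Data.Integer.Properties as ℤ
import Data.Nat.Properties as ℕ
import Relation.Binary.Reasoning.PartialOrder
import Relation.Binary.Reasoning.Setoid

-- Complete ordered fields

-- Integer coefficients let the ring solver cancel terms although equality in
-- the ring does not compute.
module IntegerCoefficientSolver (R : CommutativeRing 0ℓ 0ℓ) where
  open CommutativeRing R
  open Algebra.Properties.Ring ring using (-‿involutive; -0#≈0#; -‿+-comm; -‿distribˡ-*; -‿distribʳ-*)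
  open Algebra.Properties.Semiring.Mult.TCOptimised semiring using (×1-homo-*; ×-homo-+; 1+×) renaming (_×_ to _·_)
  open Relation.Binary.Reasoning.Setoid setoid

  ⟦_⟧ : ℤ → Carrier
  ⟦ + n ⟧      = n · 1#
  ⟦ -[1+ n ] ⟧ = - (suc n · 1#)

  ⊖-homo : ∀ m n → ⟦ m ⊖ n ⟧ ≈ m · 1# + - (n · 1#)
  ⊖-homo zero    zero    = sym (-‿inverseʳ 0#)
  ⊖-homo zero    (suc n) = sym (+-identityˡ _)
  ⊖-homo (suc m) zero    = sym (trans (+-congˡ -0#≈0#) (+-identityʳ _))
  ⊖-homo (suc m) (suc n) = begin
    ⟦ suc m ⊖ suc n ⟧                           ≡⟨ ≡.cong ⟦_⟧ (ℤ.[1+m]⊖[1+n]≡m⊖n m n) ⟩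
    ⟦ m ⊖ n ⟧                                   ≈⟨ ⊖-homo m n ⟩
    m · 1# + - (n · 1#)                         ≈⟨ +-congʳ (+-identityʳ _) ⟨
    m · 1# + 0# + - (n · 1#)                    ≈⟨ +-congʳ (+-congˡ (-‿inverseʳ 1#)) ⟨
    m · 1# + (1# + - 1#) + - (n · 1#)           ≈⟨ +-congʳ (+-assoc _ _ _) ⟨
    m · 1# + 1# + - 1# + - (n · 1#)             ≈⟨ +-assoc _ _ _ ⟩
    m · 1# + 1# + (- 1# + - (n · 1#))           ≈⟨ +-cong (+-comm _ _) (-‿+-comm _ _) ⟩
    1# + m · 1# + - (1# + n · 1#)               ≈⟨ +-cong (1+× m 1#) (-‿cong (1+× n 1#)) ⟨
    suc m · 1# + - (suc n · 1#)                 ∎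

  -‿homo : ∀ i → ⟦ ℤ.- i ⟧ ≈ - ⟦ i ⟧
  -‿homo (+ zero)  = sym -0#≈0#
  -‿homo (+ suc n) = refl
  -‿homo -[1+ n ]  = sym (-‿involutive _)

  +-homo : ∀ i j → ⟦ i ℤ.+ j ⟧ ≈ ⟦ i ⟧ + ⟦ j ⟧
  +-homo (+ m)      (+ n)      = ×-homo-+ 1# m n
  +-homo (+ m)      (-[1+ n ]) = ⊖-homo m (suc n)
  +-homo (-[1+ m ]) (+ n)      = trans (⊖-homo n (suc m)) (+-comm _ _)
  +-homo (-[1+ m ]) (-[1+ n ]) = begin
    - (suc (suc (m ℕ.+ n)) · 1#)     ≡⟨ ≡.cong (λ k → - (suc k · 1#)) (ℕ.+-suc m n) ⟨
    - ((suc m ℕ.+ suc n) · 1#)       ≈⟨ -‿cong (×-homo-+ 1# (suc m) (suc n)) ⟩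
    - (suc m · 1# + suc n · 1#)      ≈⟨ -‿+-comm _ _ ⟨
    - (suc m · 1#) + - (suc n · 1#)  ∎

  *-homo⁺ : ∀ m j → ⟦ + m ℤ.* j ⟧ ≈ ⟦ + m ⟧ * ⟦ j ⟧
  *-homo⁺ m (+ n)    = trans (reflexive (≡.cong ⟦_⟧ (≡.sym (ℤ.pos-* m n)))) (×1-homo-* m n)
  *-homo⁺ m -[1+ n ] = begin
    ⟦ + m ℤ.* (ℤ.- (+ suc n)) ⟧  ≡⟨ ≡.cong ⟦_⟧ (ℤ.neg-distribʳ-* (+ m) (+ suc n)) ⟨
    ⟦ ℤ.- (+ m ℤ.* + suc n) ⟧    ≈⟨ -‿homo (+ m ℤ.* + suc n) ⟩
    - ⟦ + m ℤ.* + suc n ⟧        ≈⟨ -‿cong (*-homo⁺ m (+ suc n)) ⟩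
    - (⟦ + m ⟧ * ⟦ + suc n ⟧)    ≈⟨ -‿distribʳ-* _ _ ⟩
    ⟦ + m ⟧ * - ⟦ + suc n ⟧      ∎

  *-homo : ∀ i j → ⟦ i ℤ.* j ⟧ ≈ ⟦ i ⟧ * ⟦ j ⟧
  *-homo (+ m)    j = *-homo⁺ m j
  *-homo -[1+ m ] j = begin
    ⟦ (ℤ.- (+ suc m)) ℤ.* j ⟧    ≡⟨ ≡.cong ⟦_⟧ (ℤ.neg-distribˡ-* (+ suc m) j) ⟨
    ⟦ ℤ.- (+ suc m ℤ.* j) ⟧      ≈⟨ -‿homo (+ suc m ℤ.* j) ⟩
    - ⟦ + suc m ℤ.* j ⟧          ≈⟨ -‿cong (*-homo⁺ (suc m) j) ⟩
    - (⟦ + suc m ⟧ * ⟦ j ⟧)      ≈⟨ -‿distribˡ-* _ _ ⟩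
    - ⟦ + suc m ⟧ * ⟦ j ⟧        ∎

  homomorphism : ℤ.+-*-rawRing ACR.-Raw-AlmostCommutative⟶ ACR.fromCommutativeRing R
  homomorphism = record
    { ⟦_⟧    = ⟦_⟧
    ; +-homo = +-homo
    ; *-homo = *-homo
    ; -‿homo = -‿homo
    ; 0-homo = refl
    ; 1-homo = refl
    }

  coefficient≟ : ∀ i j → Maybe (⟦ i ⟧ ≈ ⟦ j ⟧)
  coefficient≟ i j with i ℤ.≟ j
  ... | yes i≡j = just (reflexive (≡.cong ⟦_⟧ i≡j))
  ... | no  _   = nothing

  open Algebra.Solver.Ring _ _ homomorphism coefficient≟ public
    using (Polynomial; con; solve; _:=_; _:+_; _:*_; _:-_; :-_)

  𝟘 𝟙 : ∀ {n} → Polynomial n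
  𝟘 = con (+ 0)
  𝟙 = con (+ 1)

module OrderedField (em : ExcludedMiddle 0ℓ) (ℝ : CompleteOrderedField) where
  open CompleteOrderedField ℝ public
  open CommutativeRing commutativeRing public
    using
    ( refl; sym; trans; reflexive; setoid; zeroˡ; zeroʳ; -‿cong
    ; +-comm; +-cong; +-congˡ; +-congʳ; +-identityˡ; +-identityʳ
    ; *-assoc; *-comm; *-cong; *-congˡ; *-congʳ; *-identityˡ; *-identityʳ
    )
  open IsTotalOrder isTotalOrder public
    using (total; antisym; isPartialOrder)
    renaming (refl to ≤-refl; reflexive to ≈⇒≤; trans to ≤-trans; ≤-respˡ-≈ to ≤-respˡ; ≤-respʳ-≈ to ≤-respʳ)
  open IntegerCoefficientSolver commutativeRing public
    using (solve; _:=_; _:+_; _:*_; _:-_; :-_; 𝟘; 𝟙)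

  module ≈-Reasoning = Relation.Binary.Reasoning.Setoid setoid

  poset : Poset 0ℓ 0ℓ 0ℓ
  poset = record { isPartialOrder = isPartialOrder }

  module ≤-Reasoning = Relation.Binary.Reasoning.PartialOrder poset

  -- Strict positivity is a negated inequality, so deriving `x ≤ 0#` for a positive `x` is at once a
  -- contradiction.
  Nonneg Positive : Carrier → Set
  Nonneg x   = 0# ≤ x
  Positive x = ¬ (x ≤ 0#)

  -- Turns an inequality into a certificate: an evidently nonnegative `e` and an identity that the
  -- ring solver can check. Most estimates below have this form; proofs by contradiction use it with
  -- `y` equal to `0#`.
  by-difference : ∀ {x y e} → Nonneg e → x + e ≈ y → x ≤ y
  by-difference {x} {y} {e} 0≤e x+e≈y =
    ≤-respʳ x+e≈y (≤-respʳ (+-comm e x) (≤-respˡ (+-identityˡ x) (+-monoˡ-≤ x 0≤e)))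

  difference : ∀ {x y} → x ≤ y → Nonneg (y - x)
  difference {x} {y} x≤y = ≤-respˡ (solve 1 (λ x → x :- x := 𝟘) refl x) (+-monoˡ-≤ (- x) x≤y)

  infixl 6 _⊕_
  infixl 7 _⊗_

  _⊕_ : ∀ {x y} → Nonneg x → Nonneg y → Nonneg (x + y)
  _⊕_ {x} {y} 0≤x 0≤y = ≤-trans 0≤y (by-difference 0≤x (+-comm y x))

  _⊗_ : ∀ {x y} → Nonneg x → Nonneg y → Nonneg (x * y)
  _⊗_ = *-nonNeg

  +-mono-≤ : ∀ {a b c d} → a ≤ b → c ≤ d → a + c ≤ b + d
  +-mono-≤ {a} {b} {c} {d} a≤b c≤d = by-difference (difference a≤b ⊕ difference c≤d)
    (solve 4 (λ a b c d → (a :+ c) :+ ((b :- a) :+ (d :- c)) := b :+ d) refl a b c d)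

  *-monoʳ-≤ : ∀ {a b c} → Nonneg c → a ≤ b → a * c ≤ b * c
  *-monoʳ-≤ {a} {b} {c} 0≤c a≤b = by-difference (difference a≤b ⊗ 0≤c)
    (solve 3 (λ a b c → a :* c :+ (b :- a) :* c := b :* c) refl a b c)

  neg-mono-≤ : ∀ {a b} → a ≤ b → - b ≤ - a
  neg-mono-≤ {a} {b} a≤b = by-difference (difference a≤b)
    (solve 2 (λ a b → :- b :+ (b :- a) := :- a) refl a b)

  square-nonneg : ∀ x → Nonneg (x * x)
  square-nonneg x with total 0# x
  ... | inj₁ 0≤x = 0≤x ⊗ 0≤x
  ... | inj₂ x≤0 = ≤-respʳ (solve 1 (λ x → (𝟘 :- x) :* (𝟘 :- x) := x :* x) refl x) (difference x≤0 ⊗ difference x≤0)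

  0≤1 : Nonneg 1#
  0≤1 = ≤-respʳ (*-identityˡ 1#) (square-nonneg 1#)

  0≤2 : Nonneg 2#
  0≤2 = 0≤1 ⊕ 0≤1

  positive⇒nonneg : ∀ {x} → Positive x → Nonneg x
  positive⇒nonneg {x} x>0 with total 0# x
  ... | inj₁ 0≤x = 0≤x
  ... | inj₂ x≤0 = ⊥-elim (x>0 x≤0)

  positive⇒≉0 : ∀ {x} → Positive x → ¬ x ≈ 0#
  positive⇒≉0 x>0 x≈0 = x>0 (≈⇒≤ x≈0)

  positive-≤ : ∀ {x y} → Positive x → x ≤ y → Positive y
  positive-≤ x>0 x≤y y≤0 = x>0 (≤-trans x≤y y≤0)

  positive-1 : Positive 1#
  positive-1 1≤0 = 0≉1 (antisym 0≤1 1≤0)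

  ≰⇒positive-difference : ∀ {x y} → ¬ (x ≤ y) → Positive (x - y)
  ≰⇒positive-difference {x} {y} x≰y x-y≤0 = x≰y (by-difference (difference x-y≤0)
    (solve 2 (λ x y → x :+ (𝟘 :- (x :- y)) := y) refl x y))

  ≰⇒≥ : ∀ {x y} → ¬ (x ≤ y) → y ≤ x
  ≰⇒≥ {x} {y} x≰y with total x y
  ... | inj₁ x≤y = ⊥-elim (x≰y x≤y)
  ... | inj₂ y≤x = y≤x

  ⁻¹-inverseˡ : ∀ x → ¬ x ≈ 0# → x ⁻¹ * x ≈ 1#
  ⁻¹-inverseˡ x x≉0 = trans (*-comm _ _) (⁻¹-inverseʳ x x≉0)

  -- If the product were at most `0#`, it would be `0#`, and dividing by `y` would make `x` vanish.
  positive-* : ∀ {x y} → Positive x → Positive y → Positive (x * y)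
  positive-* {x} {y} x>0 y>0 xy≤0 = positive⇒≉0 x>0 (begin
    x               ≈⟨ *-identityʳ x ⟨
    x * 1#          ≈⟨ *-congˡ (⁻¹-inverseʳ y (positive⇒≉0 y>0)) ⟨
    x * (y * y ⁻¹)  ≈⟨ *-assoc _ _ _ ⟨
    x * y * y ⁻¹    ≈⟨ *-congʳ (antisym xy≤0 (positive⇒nonneg x>0 ⊗ positive⇒nonneg y>0)) ⟩
    0# * y ⁻¹       ≈⟨ zeroˡ _ ⟩
    0#              ∎)
    where open ≈-Reasoning

  positive-⁻¹ : ∀ {x} → Positive x → Positive (x ⁻¹)
  positive-⁻¹ {x} x>0 x⁻¹≤0 = positive-1 (by-difference (positive⇒nonneg x>0 ⊗ difference x⁻¹≤0) (begin
    1# + x * (0# - x ⁻¹)  ≈⟨ solve 2 (λ x y → 𝟙 :+ x :* (𝟘 :- y) := 𝟙 :- x :* y) refl x (x ⁻¹) ⟩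
    1# - x * x ⁻¹         ≈⟨ +-congˡ (-‿cong (⁻¹-inverseʳ x (positive⇒≉0 x>0))) ⟩
    1# - 1#               ≈⟨ solve 0 (𝟙 :- 𝟙 := 𝟘) refl ⟩
    0#                    ∎))
    where open ≈-Reasoning

  ⁻¹-unique : ∀ {x y} → x * y ≈ 1# → x ⁻¹ ≈ y
  ⁻¹-unique {x} {y} xy≈1 = begin
    x ⁻¹             ≈⟨ *-identityʳ _ ⟨
    x ⁻¹ * 1#        ≈⟨ *-congˡ xy≈1 ⟨
    x ⁻¹ * (x * y)   ≈⟨ *-assoc _ _ _ ⟨
    x ⁻¹ * x * y     ≈⟨ *-congʳ (⁻¹-inverseˡ x x≉0) ⟩
    1# * y           ≈⟨ *-identityˡ y ⟩
    y                ∎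
    where
    open ≈-Reasoning
    x≉0 : ¬ x ≈ 0#
    x≉0 x≈0 = 0≉1 (trans (sym (zeroˡ y)) (trans (*-congʳ (sym x≈0)) xy≈1))

  -- Multiply `u ⁻¹ ≤ v` by `u` and then by `v ⁻¹`. This form of order reversal translates a bound
  -- on `1 / (t - 1)` into a bound on `t`.
  ⁻¹-≤-swap : ∀ {u v} → Positive u → Positive v → u ⁻¹ ≤ v → v ⁻¹ ≤ u
  ⁻¹-≤-swap {u} {v} u>0 v>0 u⁻¹≤v = begin
    v ⁻¹               ≈⟨ *-identityˡ _ ⟨
    1# * v ⁻¹          ≈⟨ *-congʳ (⁻¹-inverseˡ u (positive⇒≉0 u>0)) ⟨
    u ⁻¹ * u * v ⁻¹    ≤⟨ *-monoʳ-≤ (positive⇒nonneg (positive-⁻¹ v>0)) (*-monoʳ-≤ (positive⇒nonneg u>0) u⁻¹≤v) ⟩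
    v * u * v ⁻¹       ≈⟨ solve 3 (λ u v w → v :* u :* w := u :* (v :* w)) refl u v (v ⁻¹) ⟩
    u * (v * v ⁻¹)     ≈⟨ *-congˡ (⁻¹-inverseʳ v (positive⇒≉0 v>0)) ⟩
    u * 1#             ≈⟨ *-identityʳ u ⟩
    u                  ∎
    where open ≤-Reasoning

  1⁻¹≈1 : 1# ⁻¹ ≈ 1#
  1⁻¹≈1 = ⁻¹-unique (*-identityˡ 1#)

  square≈0⇒≈0 : ∀ {x} → x * x ≈ 0# → x ≈ 0#
  square≈0⇒≈0 {x} xx≈0 = decidable-stable em λ x≉0 → x≉0 (begin
    x               ≈⟨ *-identityʳ x ⟨
    x * 1#          ≈⟨ *-congˡ (⁻¹-inverseʳ x x≉0) ⟨
    x * (x * x ⁻¹)  ≈⟨ *-assoc _ _ _ ⟨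
    x * x * x ⁻¹    ≈⟨ *-congʳ xx≈0 ⟩
    0# * x ⁻¹       ≈⟨ zeroˡ _ ⟩
    0#              ∎)
    where open ≈-Reasoning

  -- If `e = x - y` were positive, take `δ = e / (B + 1 + e)`. Then `e = δ * (B + 1 + e)`, while the
  -- hypothesis gives `e ≤ δ * B`, so `δ * (1 + e) ≤ 0`, which is absurd. Restricting to `δ ≤ 1#`
  -- lets callers bound `δ * δ` by `δ`.
  ≤-by-approximation : ∀ {x y B} → Nonneg B →
    (∀ δ → Positive δ → δ ≤ 1# → x ≤ y + δ * B) → x ≤ y
  ≤-by-approximation {x} {y} {B} 0≤B approx = decidable-stable em λ x≰y →
    let
      e = x - y
      w = B + 1# + e
      δ = e * w ⁻¹
      e>0 = ≰⇒positive-difference x≰y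
      0≤e = positive⇒nonneg e>0
      w>0 = positive-≤ positive-1 (by-difference (0≤B ⊕ 0≤e)
        (solve 2 (λ B e → 𝟙 :+ (B :+ e) := B :+ 𝟙 :+ e) refl B e))
      δ>0 = positive-* e>0 (positive-⁻¹ w>0)
      δw≈e : δ * w ≈ e
      δw≈e = trans (*-assoc _ _ _) (trans (*-congˡ (⁻¹-inverseˡ w (positive⇒≉0 w>0))) (*-identityʳ e))
      δ≤1 : δ ≤ 1#
      δ≤1 = ≤-respʳ (⁻¹-inverseʳ w (positive⇒≉0 w>0)) (*-monoʳ-≤ (positive⇒nonneg (positive-⁻¹ w>0))
        (by-difference (0≤B ⊕ 0≤1) (solve 2 (λ B e → e :+ (B :+ 𝟙) := B :+ 𝟙 :+ e) refl B e)))
      1+e>0 = positive-≤ positive-1 (by-difference 0≤e refl)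
    in positive-* δ>0 1+e>0 (by-difference (difference (approx δ δ>0 δ≤1)) (begin
      δ * (1# + (x - y)) + (y + δ * B - x)
        ≈⟨ solve 4 (λ δ B x y → δ :* (𝟙 :+ (x :- y)) :+ (y :+ δ :* B :- x) := δ :* (B :+ 𝟙 :+ (x :- y)) :+ (y :- x)) refl δ B x y ⟩
      δ * w + (y - x)
        ≈⟨ +-congʳ δw≈e ⟩
      (x - y) + (y - x)
        ≈⟨ solve 2 (λ x y → (x :- y) :+ (y :- x) := 𝟘) refl x y ⟩
      0#  ∎))
    where open ≈-Reasoning

  -- If no element of `S` came within `δ` of `s`, then `s - δ` would be a smaller upper bound.
  supremum-approx : (S : Carrier → Set) → ∃ S → ∃ (UpperBound S) →
    ∃[ s ] (UpperBound S s × (∀ δ → Positive δ → ∃[ x ] (S x × s ≤ x + δ)))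
  supremum-approx S nonempty bounded with supremum S nonempty bounded
  ... | s , s-upper , s-least = s , s-upper , λ δ δ>0 → decidable-stable em λ none →
    δ>0 (by-difference
      (difference (s-least (s - δ) λ x x∈S →
        by-difference (difference (≰⇒≥ (λ s≤x+δ → none (x , x∈S , s≤x+δ))))
          (solve 3 (λ s x δ → x :+ (s :- (x :+ δ)) := s :- δ) refl s x δ)))
      (solve 2 (λ s δ → δ :+ ((s :- δ) :- s) := 𝟘) refl s δ))

  -- Otherwise `x - y` and `x + y` are both positive, and so is their product `x * x - y * y`.
  square-cancel-≤ : ∀ {x y} → Nonneg y → x * x ≤ y * y → x ≤ y
  square-cancel-≤ {x} {y} 0≤y xx≤yy = decidable-stable em λ x≰y →
    let x-y>0 = ≰⇒positive-difference x≰y in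
    positive-* x-y>0 (positive-≤ x-y>0 (by-difference (0≤y ⊕ 0≤y)
        (solve 2 (λ x y → (x :- y) :+ (y :+ y) := x :+ y) refl x y)))
      (by-difference (difference xx≤yy)
        (solve 2 (λ x y → (x :- y) :* (x :+ y) :+ (y :* y :- x :* x) := 𝟘) refl x y))

  square-mono-≤ : ∀ {x y} → Nonneg x → x ≤ y → x * x ≤ y * y
  square-mono-≤ {x} {y} 0≤x x≤y = by-difference (difference x≤y ⊗ (0≤x ⊕ ≤-trans 0≤x x≤y))
    (solve 2 (λ x y → x :* x :+ (y :- x) :* (x :+ y) := y :* y) refl x y)

  -- The root is the supremum `r` of `S`. Both halves of `r * r ≈ a` are proved up to an error
  -- linear in `δ`: `r` exceeds some element of `S` by at most `δ`, and `r + δ` lies outside `S`.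
  square-root : ∀ {a} → Nonneg a → ∃[ r ] r * r ≈ a
  square-root {a} 0≤a = root (supremum-approx S (0# , 0∈S) (1# + a , S-bounded))
    where
    S : Carrier → Set
    S x = x * x ≤ a
    0∈S : S 0#
    0∈S = ≤-respˡ (sym (zeroˡ 0#)) 0≤a
    -- `1# + a` bounds `S` whether `a` is small or large, because `a ≤ (1 + a)²`.
    B : Carrier
    B = 1# + a
    0≤B : Nonneg B
    0≤B = 0≤1 ⊕ 0≤a
    S-bounded : UpperBound S B
    S-bounded x xx≤a = square-cancel-≤ 0≤B (≤-trans xx≤a (by-difference (0≤B ⊕ square-nonneg a)
      (solve 1 (λ a → a :+ (𝟙 :+ a :+ a :* a) := (𝟙 :+ a) :* (𝟙 :+ a)) refl a)))
    root : ∃[ r ] (UpperBound S r × (∀ δ → Positive δ → ∃[ x ] (S x × r ≤ x + δ))) → ∃[ r ] r * r ≈ a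
    root (r , r-upper , r-approx) = r , antisym (≤-by-approximation (0≤B ⊕ 0≤B ⊕ 0≤1) r²≤) (≤-by-approximation (0≤r ⊕ 0≤r ⊕ 0≤1) a≤)
      where
      0≤r : Nonneg r
      0≤r = r-upper 0# 0∈S
      r²≤ : ∀ δ → Positive δ → δ ≤ 1# → r * r ≤ a + δ * (B + B + 1#)
      r²≤ δ δ>0 δ≤1 with r-approx δ δ>0
      ... | x , xx≤a , r≤x+δ = ≤-trans (square-mono-≤ 0≤r r≤x+δ) (by-difference
        (difference xx≤a ⊕ positive⇒nonneg δ>0 ⊗ (difference (S-bounded x xx≤a) ⊕ difference (S-bounded x xx≤a) ⊕ difference δ≤1))
        (solve 4 (λ x a b δ → (x :+ δ) :* (x :+ δ) :+ (a :- x :* x :+ δ :* ((b :- x) :+ (b :- x) :+ (𝟙 :- δ)))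
          := a :+ δ :* (b :+ b :+ 𝟙)) refl x a B δ))
      a≤ : ∀ δ → Positive δ → δ ≤ 1# → a ≤ r * r + δ * (r + r + 1#)
      a≤ δ δ>0 δ≤1 = ≤-trans
        (≰⇒≥ λ [r+δ]²≤a → δ>0 (by-difference (difference (r-upper (r + δ) [r+δ]²≤a))
          (solve 2 (λ r δ → δ :+ (r :- (r :+ δ)) := 𝟘) refl r δ)))
        (by-difference (positive⇒nonneg δ>0 ⊗ difference δ≤1)
          (solve 2 (λ r δ → (r :+ δ) :* (r :+ δ) :+ δ :* (𝟙 :- δ) := r :* r :+ δ :* (r :+ r :+ 𝟙)) refl r δ))

-- Compactness and attained maxima

module Compactness (em : ExcludedMiddle 0ℓ) (ℝ : CompleteOrderedField) where
  open OrderedField em ℝ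

  Within : Carrier → Carrier → Carrier → Set
  Within ε a b = a ≤ b + ε × b ≤ a + ε

  Close : ∀ {N} → Carrier → Vector Carrier N → Vector Carrier N → Set
  Close ε x y = ∀ k → Within ε (x k) (y k)

  BoundedBy : ∀ {N} → Carrier → (Vector Carrier N → Set) → Set
  BoundedBy B C = ∀ {x} → C x → ∀ k → - B ≤ x k × x k ≤ B

  -- Closedness in the maximum norm, phrased by approximating points instead of sequences.
  Closed : ∀ {N} → (Vector Carrier N → Set) → Set
  Closed C = ∀ x → (∀ ε → Positive ε → ∃[ y ] (C y × Close ε x y)) → C x

  positive-min : ∀ {a b} → Positive a → Positive b → ∃[ c ] (Positive c × c ≤ a × c ≤ b)
  positive-min {a} {b} a>0 b>0 with total a b
  ... | inj₁ a≤b = a , a>0 , ≤-refl , a≤b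
  ... | inj₂ b≤a = b , b>0 , b≤a , ≤-refl

  -- The first coordinate is the limit inferior of the first coordinates of D ε.
  cluster-point : ∀ N (D : Carrier → Vector Carrier N → Set) B →
    (∀ {ε ε′} → ε ≤ ε′ → ∀ {x} → D ε x → D ε′ x) →
    (∀ ε → Positive ε → ∃ (D ε)) →
    (∀ ε → BoundedBy B (D ε)) →
    ∃[ x ] (∀ ε → Positive ε → ∃[ y ] (D ε y × Close ε x y))
  cluster-point zero    D B mono inhabited bounded = (λ ()) , λ ε ε>0 →
    proj₁ (inhabited ε ε>0) , proj₂ (inhabited ε ε>0) , λ ()
  cluster-point (suc N) D B mono inhabited bounded = extend (supremum-approx S
      (- B , 1# , positive-1 , λ y y∈D → proj₁ (bounded 1# y∈D zero))
      (B , λ { a (ε , ε>0 , a-lower) → let y , y∈D = inhabited ε ε>0 in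
        ≤-trans (a-lower y y∈D) (proj₂ (bounded ε y∈D zero)) }))
    where
    S : Carrier → Set
    S a = ∃[ ε ] (Positive ε × ∀ y → D ε y → a ≤ y zero)
    extend : ∃[ s ] (UpperBound S s × (∀ δ → Positive δ → ∃[ a ] (S a × s ≤ a + δ))) →
      ∃[ x ] (∀ ε → Positive ε → ∃[ y ] (D ε y × Close ε x y))
    extend (s , s-upper , s-approx) = s ∷ proj₁ tail , λ ε ε>0 → close ε (proj₂ tail ε ε>0)
      where
      -- Only points whose first coordinate is already near `s` are projected, so a cluster point of
      -- the tails can be extended by `s`.
      D′ : Carrier → Vector Carrier N → Set
      D′ ε z = ∃[ y ] (D ε y × Within ε s (y zero) × y ∘ suc ≡ z)

      inhabited′ : ∀ ε → Positive ε → ∃ (D′ ε)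
      inhabited′ ε ε>0 with s-approx ε ε>0
      ... | a , (ε₁ , ε₁>0 , a-lower) , s≤a+ε with positive-min ε>0 ε₁>0
      ... | ε₂ , ε₂>0 , ε₂≤ε , ε₂≤ε₁ = decidable-stable em λ none →
        -- If no first coordinate in `D ε₂` were within `ε` of `s`, then all of them, being at least
        -- `s - ε`, would be at least `s + ε`. Then `s + ε` would lie in `S`, above its supremum.
        ε>0 (by-difference
          (difference (s-upper (s + ε) (ε₂ , ε₂>0 , λ y y∈D → ≰⇒≥ λ y≤s+ε →
            none (y ∘ suc , y , mono ε₂≤ε y∈D ,
              (≤-trans s≤a+ε (+-monoˡ-≤ ε (a-lower y (mono ε₂≤ε₁ y∈D))) , y≤s+ε) , ≡.refl))))
          (solve 2 (λ s ε → ε :+ (s :- (s :+ ε)) := 𝟘) refl s ε))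

      tail : ∃[ z ] (∀ ε → Positive ε → ∃[ z′ ] (D′ ε z′ × Close ε z z′))
      tail = cluster-point N D′ B
        (λ { {ε} {ε′} ε≤ε′ (y , y∈D , (s≤y+ε , y≤s+ε) , eq) → y , mono ε≤ε′ y∈D ,
          (≤-trans s≤y+ε (+-mono-≤ ≤-refl ε≤ε′) , ≤-trans y≤s+ε (+-mono-≤ ≤-refl ε≤ε′)) , eq })
        inhabited′
        (λ { ε (y , y∈D , _ , ≡.refl) k → bounded ε y∈D (suc k) })

      close : ∀ ε → ∃[ z′ ] (D′ ε z′ × Close ε (proj₁ tail) z′) →
        ∃[ y ] (D ε y × Close ε (s ∷ proj₁ tail) y)
      close ε (_ , (y , y∈D , s-near , ≡.refl) , near) =
        y , y∈D , λ { zero → s-near ; (suc k) → near k }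

  -- The points of `C` whose first coordinate is within `ε` of the supremum cluster somewhere as `ε`
  -- shrinks. The cluster point lies in `C` by closedness, and its first coordinate reaches the
  -- supremum.
  maximise-first : ∀ {N} (C : Vector Carrier (suc N) → Set) B →
    Closed C → BoundedBy B C → ∃ C →
    ∃[ x ] (C x × ∀ y → C y → y zero ≤ x zero)
  maximise-first {N} C B closed bounded (c , c∈C) = attain (supremum-approx S
      (c zero , c , c∈C , ≡.refl)
      (B , λ { _ (y , y∈C , ≡.refl) → proj₂ (bounded y∈C zero) }))
    where
    S : Carrier → Set
    S a = ∃[ y ] (C y × y zero ≡ a)
    attain : ∃[ s ] (UpperBound S s × (∀ δ → Positive δ → ∃[ a ] (S a × s ≤ a + δ))) →
      ∃[ x ] (C x × ∀ y → C y → y zero ≤ x zero)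
    attain (s , s-upper , s-approx) = finish (cluster-point (suc N) D B
        (λ { ε≤ε′ (y∈C , s≤y+ε) → y∈C , ≤-trans s≤y+ε (+-mono-≤ ≤-refl ε≤ε′) })
        (λ ε ε>0 → nearly (s-approx ε ε>0))
        (λ ε y∈D → bounded (proj₁ y∈D)))
      where
      D : Carrier → Vector Carrier (suc N) → Set
      D ε y = C y × s ≤ y zero + ε
      nearly : ∀ {ε} → ∃[ a ] (S a × s ≤ a + ε) → ∃ (D ε)
      nearly (_ , (y , y∈C , ≡.refl) , s≤y+ε) = y , y∈C , s≤y+ε
      finish : ∃[ x ] (∀ ε → Positive ε → ∃[ y ] (D ε y × Close ε x y)) →
        ∃[ x ] (C x × ∀ y → C y → y zero ≤ x zero)
      finish (x , near) = x ,
        closed x (λ ε ε>0 → let y , (y∈C , _) , x~y = near ε ε>0 in y , y∈C , x~y) ,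
        -- One `δ` is lost between the supremum and `z`, another between `z` and `x`; hence the
        -- constant `2#`.
        λ y y∈C → ≤-by-approximation 0≤2 λ δ δ>0 _ →
          let z , (z∈C , s≤z+δ) , x~z = near δ δ>0 in
          chain (s-upper (y zero) (y , y∈C , ≡.refl)) s≤z+δ (proj₂ (x~z zero))
        where
        chain : ∀ {y s z x δ} → y ≤ s → s ≤ z + δ → z ≤ x + δ → y ≤ x + δ * 2#
        chain {x = x} {δ} y≤s s≤z+δ z≤x+δ = ≤-trans y≤s (≤-trans s≤z+δ
          (≤-respʳ (solve 2 (λ x δ → x :+ δ :+ δ := x :+ δ :* (𝟙 :+ 𝟙)) refl x δ) (+-monoˡ-≤ δ z≤x+δ)))

  -- The one-sided estimate suffices, since `Close` is symmetric and the two points can be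
  -- exchanged.
  Lipschitz : ∀ {N} → (Vector Carrier N → Carrier) → Set
  Lipschitz L = ∃[ B ] (Nonneg B × ∀ {ε x y} → Close ε x y → L x ≤ L y + ε * B)

  Close-sym : ∀ {N ε} {x y : Vector Carrier N} → Close ε x y → Close ε y x
  Close-sym near k = proj₂ (near k) , proj₁ (near k)

  lipschitz-coordinate : ∀ {N} (k : Fin N) → Lipschitz (λ x → x k)
  lipschitz-coordinate k = 1# , 0≤1 , λ near → ≤-respʳ (+-congˡ (sym (*-identityʳ _))) (proj₁ (near k))

  lipschitz-const : ∀ {N} c → Lipschitz {N} (λ _ → c)
  lipschitz-const c = 0# , ≤-refl , λ {ε} _ → ≈⇒≤ (solve 2 (λ c ε → c := c :+ ε :* 𝟘) refl c ε)

  lipschitz-+ : ∀ {N} {L M : Vector Carrier N → Carrier} →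
    Lipschitz L → Lipschitz M → Lipschitz (λ x → L x + M x)
  lipschitz-+ {L = L} {M} (B , 0≤B , L-lip) (C , 0≤C , M-lip) = B + C , 0≤B ⊕ 0≤C , λ {ε} {x} {y} near →
    ≤-respʳ (solve 5 (λ l m ε B C → l :+ ε :* B :+ (m :+ ε :* C) := l :+ m :+ ε :* (B :+ C)) refl (L y) (M y) ε B C)
      (+-mono-≤ (L-lip near) (M-lip near))

  lipschitz-scale : ∀ {N} {L : Vector Carrier N → Carrier} c → Lipschitz L → Lipschitz (λ x → L x * c)
  lipschitz-scale {L = L} c (B , 0≤B , L-lip) with total 0# c
  ... | inj₁ 0≤c = B * c , 0≤B ⊗ 0≤c , λ {ε} {x} {y} near →
    ≤-respʳ (solve 4 (λ l ε B c → (l :+ ε :* B) :* c := l :* c :+ ε :* (B :* c)) refl (L y) ε B c)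
      (*-monoʳ-≤ 0≤c (L-lip near))
  -- A negative factor reverses the inequality, so the hypothesis is used with `x` and `y`
  -- exchanged.
  ... | inj₂ c≤0 = B * (0# - c) , 0≤B ⊗ difference c≤0 , λ {ε} {x} {y} near →
    by-difference (difference (L-lip (Close-sym near)) ⊗ difference c≤0)
      (solve 5 (λ l m ε B c → l :* c :+ (l :+ ε :* B :- m) :* (𝟘 :- c) := m :* c :+ ε :* (B :* (𝟘 :- c))) refl (L x) (L y) ε B c)

  lipschitz-neg : ∀ {N} {L : Vector Carrier N → Carrier} → Lipschitz L → Lipschitz (λ x → - L x)
  lipschitz-neg {L = L} (B , 0≤B , L-lip) = B , 0≤B , λ {ε} {x} {y} near →
    by-difference (difference (L-lip (Close-sym near)))
      (solve 4 (λ l m ε B → :- l :+ (l :+ ε :* B :- m) := :- m :+ ε :* B) refl (L x) (L y) ε B)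

  -- Compare `L` and `M` at a nearby point `y` of the set; returning to `x` costs at most
  -- `δ * (B + C)`.
  closed-≤ : ∀ {N} {L M : Vector Carrier N → Carrier} →
    Lipschitz L → Lipschitz M → Closed (λ x → L x ≤ M x)
  closed-≤ {L = L} {M} (B , 0≤B , L-lip) (C , 0≤C , M-lip) x near =
    ≤-by-approximation (0≤B ⊕ 0≤C) λ δ δ>0 _ →
      let y , Ly≤My , x~y = near δ δ>0 in
      by-difference (difference (L-lip x~y) ⊕ difference Ly≤My ⊕ difference (M-lip (Close-sym x~y)))
        (solve 7 (λ l m l′ m′ δ B C → l :+ ((l′ :+ δ :* B :- l) :+ (m′ :- l′) :+ (m :+ δ :* C :- m′)) := m :+ δ :* (B :+ C))
          refl (L x) (M x) (L y) (M y) δ B C)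

  closed-∩ : ∀ {N} {P Q : Vector Carrier N → Set} → Closed P → Closed Q → Closed (λ x → P x × Q x)
  closed-∩ P-closed Q-closed x near =
    P-closed x (λ ε ε>0 → let y , (y∈P , _) , x~y = near ε ε>0 in y , y∈P , x~y) ,
    Q-closed x (λ ε ε>0 → let y , (_ , y∈Q) , x~y = near ε ε>0 in y , y∈Q , x~y)

  closed-∀ : ∀ {N} {I : Set} {P : I → Vector Carrier N → Set} →
    (∀ i → Closed (P i)) → Closed (λ x → ∀ i → P i x)
  closed-∀ P-closed x near i =
    P-closed i x (λ ε ε>0 → let y , y∈P , x~y = near ε ε>0 in y , y∈P i , x~y)

  closed-≈ : ∀ {N} {L M : Vector Carrier N → Carrier} →
    Lipschitz L → Lipschitz M → Closed (λ x → L x ≈ M x)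
  closed-≈ L-lip M-lip x near = antisym
    (closed-≤ L-lip M-lip x λ ε ε>0 → let y , y∈P , x~y = near ε ε>0 in y , ≈⇒≤ y∈P , x~y)
    (closed-≤ M-lip L-lip x λ ε ε>0 → let y , y∈P , x~y = near ε ε>0 in y , ≈⇒≤ (sym y∈P) , x~y)

-- Positive semidefinite matrices

module QuadraticForm (em : ExcludedMiddle 0ℓ) (ℝ : CompleteOrderedField) where
  open OrderedField em ℝ
  open Compactness em ℝ
  open Algebra.Properties.Monoid.Sum +-monoid using (sum-cong-≋)

  infix 8 _∙_
  _∙_ : ∀ {d} → Vector Carrier d → Vector Carrier d → Carrier
  u ∙ v = ⟨_,_⟩ ℝ u v

  Matrix : ℕ → Set
  Matrix n = Fin n → Fin n → Carrier

  ∙-cong : ∀ {d} {u u′ v v′ : Vector Carrier d} →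
    SameVector ℝ u u′ → SameVector ℝ v v′ → u ∙ v ≈ u′ ∙ v′
  ∙-cong u≈u′ v≈v′ = sum-cong-≋ λ k → *-cong (u≈u′ k) (v≈v′ k)

  ∙-comm : ∀ {d} (u v : Vector Carrier d) → u ∙ v ≈ v ∙ u
  ∙-comm u v = sum-cong-≋ λ k → *-comm (u k) (v k)

  ∙-linearˡ : ∀ {d} (u v w : Vector Carrier d) m → (λ k → u k + m * v k) ∙ w ≈ u ∙ w + m * (v ∙ w)
  ∙-linearˡ {zero}  u v w m = solve 1 (λ m → 𝟘 := 𝟘 :+ m :* 𝟘) refl m
  ∙-linearˡ {suc d} u v w m = trans (+-congˡ (∙-linearˡ (u ∘ suc) (v ∘ suc) (w ∘ suc) m))
    (solve 6 (λ u v w m x y → (u :+ m :* v) :* w :+ (x :+ m :* y) := u :* w :+ x :+ m :* (v :* w :+ y))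
      refl (u zero) (v zero) (w zero) m ((u ∘ suc) ∙ (w ∘ suc)) ((v ∘ suc) ∙ (w ∘ suc)))

  ∙-zeroˡ : ∀ {d} (u : Vector Carrier d) → const 0# ∙ u ≈ 0#
  ∙-zeroˡ {zero}  u = refl
  ∙-zeroˡ {suc d} u = trans (+-cong (zeroˡ _) (∙-zeroˡ (u ∘ suc))) (+-identityˡ 0#)

  ∙-zeroʳ : ∀ {d} (u : Vector Carrier d) → u ∙ const 0# ≈ 0#
  ∙-zeroʳ u = trans (∙-comm u (const 0#)) (∙-zeroˡ u)

  ∙-nonneg : ∀ {d} (u : Vector Carrier d) → Nonneg (u ∙ u)
  ∙-nonneg {zero}  u = ≤-refl
  ∙-nonneg {suc d} u = square-nonneg (u zero) ⊕ ∙-nonneg (u ∘ suc)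

  ∙-definite : ∀ {d} (u : Vector Carrier d) → u ∙ u ≤ 0# → ∀ k → u k ≈ 0#
  ∙-definite {suc d} u u∙u≤0 zero = square≈0⇒≈0 (antisym
    (≤-trans (by-difference (∙-nonneg (u ∘ suc)) refl) u∙u≤0) (square-nonneg (u zero)))
  ∙-definite {suc d} u u∙u≤0 (suc k) = ∙-definite (u ∘ suc)
    (≤-trans (by-difference (square-nonneg (u zero)) (+-comm _ _)) u∙u≤0) k

  ∙-expand : ∀ {d} (u v : Vector Carrier d) m →
    (λ k → u k + m * v k) ∙ (λ k → u k + m * v k) ≈ u ∙ u + m * (u ∙ v + u ∙ v) + m * m * (v ∙ v)
  ∙-expand u v m = begin
    w ∙ w                                    ≈⟨ ∙-linearˡ u v w m ⟩
    u ∙ w + m * (v ∙ w)                      ≈⟨ +-cong (∙-comm u w) (*-congˡ (∙-comm v w)) ⟩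
    w ∙ u + m * (w ∙ v)                      ≈⟨ +-cong (∙-linearˡ u v u m) (*-congˡ (∙-linearˡ u v v m)) ⟩
    u ∙ u + m * (v ∙ u) + m * (u ∙ v + m * (v ∙ v))
                                             ≈⟨ +-congʳ (+-congˡ (*-congˡ (∙-comm v u))) ⟩
    u ∙ u + m * (u ∙ v) + m * (u ∙ v + m * (v ∙ v))
                                             ≈⟨ solve 4 (λ a b c m → a :+ m :* b :+ m :* (b :+ m :* c) := a :+ m :* (b :+ b) :+ m :* m :* c) refl (u ∙ u) (u ∙ v) (v ∙ v) m ⟩
    u ∙ u + m * (u ∙ v + u ∙ v) + m * m * (v ∙ v)  ∎
    where
    open ≈-Reasoning
    w = λ k → u k + m * v k

  ≤-by-doubling : ∀ {a b} → a + a ≤ b + b → a ≤ b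
  ≤-by-doubling {a} {b} a+a≤b+b = decidable-stable em λ a≰b →
    ≰⇒positive-difference a≰b (by-difference (difference a+a≤b+b ⊕ positive⇒nonneg (≰⇒positive-difference a≰b))
      (solve 2 (λ a b → a :- b :+ (b :+ b :- (a :+ a) :+ (a :- b)) := 𝟘) refl a b))

  -- The squared norms of `u + v` and `u - v` are nonnegative, and they expand to `2 + 2 (u ∙ v)`
  -- and `2 - 2 (u ∙ v)`.
  unit⇒∙-bounded : ∀ {d} {u v : Vector Carrier d} → u ∙ u ≈ 1# → v ∙ v ≈ 1# → - 1# ≤ u ∙ v × u ∙ v ≤ 1#
  unit⇒∙-bounded {u = u} {v} uu≈1 vv≈1 =
    ≤-by-doubling (by-difference (≤-respʳ (expand 1#) (∙-nonneg (λ k → u k + 1# * v k)))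
      (solve 1 (λ b → :- 𝟙 :+ :- 𝟙 :+ (𝟙 :+ 𝟙 :* (b :+ b) :+ 𝟙 :* 𝟙 :* 𝟙) := b :+ b) refl (u ∙ v))) ,
    ≤-by-doubling (by-difference (≤-respʳ (expand (- 1#)) (∙-nonneg (λ k → u k + - 1# * v k)))
      (solve 1 (λ b → b :+ b :+ (𝟙 :+ (:- 𝟙) :* (b :+ b) :+ (:- 𝟙) :* (:- 𝟙) :* 𝟙) := 𝟙 :+ 𝟙) refl (u ∙ v)))
    where
    expand : ∀ m → (λ k → u k + m * v k) ∙ (λ k → u k + m * v k) ≈ 1# + m * (u ∙ v + u ∙ v) + m * m * 1#
    expand m = trans (∙-expand u v m) (+-cong (+-congʳ uu≈1) (*-congˡ vv≈1))

  -- The squared distance of two vectors is a combination of their inner products, so `u - v` has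
  -- the same norm as `u′ - v′`, namely zero.
  same-gram⇒sameVector : ∀ {d e} {u v : Vector Carrier d} {u′ v′ : Vector Carrier e} →
    u ∙ u ≈ u′ ∙ u′ → u ∙ v ≈ u′ ∙ v′ → v ∙ v ≈ v′ ∙ v′ →
    SameVector ℝ u′ v′ → SameVector ℝ u v
  same-gram⇒sameVector {u = u} {v} {u′} {v′} uu uv vv u′≈v′ k = begin
    u k                      ≈⟨ solve 2 (λ x y → x := x :+ (:- 𝟙) :* y :+ y) refl (u k) (v k) ⟩
    u k + - 1# * v k + v k   ≈⟨ +-congʳ (∙-definite (λ k → u k + - 1# * v k) (≈⇒≤ w∙w≈0) k) ⟩
    0# + v k                 ≈⟨ +-identityˡ _ ⟩
    v k                      ∎
    where
    open ≈-Reasoning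
    w∙w≈0 : (λ k → u k + - 1# * v k) ∙ (λ k → u k + - 1# * v k) ≈ 0#
    w∙w≈0 = begin
      _                                                                  ≈⟨ ∙-expand u v (- 1#) ⟩
      u ∙ u + - 1# * (u ∙ v + u ∙ v) + - 1# * - 1# * (v ∙ v)             ≈⟨ +-cong (+-cong uu (*-congˡ (+-cong uv uv))) (*-congˡ vv) ⟩
      u′ ∙ u′ + - 1# * (u′ ∙ v′ + u′ ∙ v′) + - 1# * - 1# * (v′ ∙ v′)     ≈⟨ +-congʳ (+-cong (∙-cong u′≈v′ u′≈v′) (*-congˡ (+-cong u′v′≈v′v′ u′v′≈v′v′))) ⟩
      v′ ∙ v′ + - 1# * (v′ ∙ v′ + v′ ∙ v′) + - 1# * - 1# * (v′ ∙ v′)     ≈⟨ solve 1 (λ a → a :+ (:- 𝟙) :* (a :+ a) :+ (:- 𝟙) :* (:- 𝟙) :* a := 𝟘) refl (v′ ∙ v′) ⟩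
      0#                                                                 ∎
      where
      u′v′≈v′v′ : u′ ∙ v′ ≈ v′ ∙ v′
      u′v′≈v′v′ = ∙-cong u′≈v′ (λ _ → refl)

  -- Only the upper triangle of the matrix is read.
  form : ∀ {n} → Matrix n → Vector Carrier n → Carrier
  form {zero}  M c = 0#
  form {suc n} M c = M zero zero * (c zero * c zero) + (M zero ∘ suc) ∙ (c ∘ suc) * (2# * c zero)
    + form (λ i j → M (suc i) (suc j)) (c ∘ suc)

  form-cong : ∀ {n} {M M′ : Matrix n} c → (∀ i j → M i j ≈ M′ i j) → form M c ≈ form M′ c
  form-cong {zero}  c M≈M′ = refl
  form-cong {suc n} c M≈M′ = +-cong
    (+-cong (*-congʳ (M≈M′ zero zero)) (*-congʳ (∙-cong (M≈M′ zero ∘ suc) (λ _ → refl))))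
    (form-cong (c ∘ suc) λ i j → M≈M′ (suc i) (suc j))

  -- The common tool for Gram matrices, Schur complements and the simplex matrix, each of which is a
  -- simpler matrix plus a rank-one term.
  form-rank-one : ∀ {n} (M : Matrix n) m b c →
    form (λ i j → M i j + m * b i * b j) c ≈ form M c + m * (b ∙ c * (b ∙ c))
  form-rank-one {zero}  M m b c = solve 1 (λ m → 𝟘 := 𝟘 :+ m :* (𝟘 :* 𝟘)) refl m
  form-rank-one {suc n} M m b c = trans
    (+-cong (+-congˡ (*-congʳ (∙-linearˡ (M zero ∘ suc) (b ∘ suc) (c ∘ suc) (m * b zero))))
      (form-rank-one (λ i j → M (suc i) (suc j)) m (b ∘ suc) (c ∘ suc)))
    (solve 7 (λ a m b c r β q →
        (a :+ m :* b :* b) :* (c :* c) :+ (r :+ m :* b :* β) :* ((𝟙 :+ 𝟙) :* c) :+ (q :+ m :* (β :* β))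
        := a :* (c :* c) :+ r :* ((𝟙 :+ 𝟙) :* c) :+ q :+ m :* ((b :* c :+ β) :* (b :* c :+ β)))
      refl (M zero zero) m (b zero) (c zero) ((M zero ∘ suc) ∙ (c ∘ suc)) ((b ∘ suc) ∙ (c ∘ suc))
      (form (λ i j → M (suc i) (suc j)) (c ∘ suc)))

  form-zero : ∀ {n} c → form {n} (λ _ _ → 0#) c ≈ 0#
  form-zero {zero}  c = refl
  form-zero {suc n} c = trans (+-cong (+-congˡ (*-congʳ (∙-zeroˡ (c ∘ suc)))) (form-zero (c ∘ suc)))
    (solve 1 (λ c → 𝟘 :* (c :* c) :+ 𝟘 :* ((𝟙 :+ 𝟙) :* c) :+ 𝟘 := 𝟘) refl (c zero))

  form-at-zero : ∀ {n} (M : Matrix n) → form M (const 0#) ≈ 0#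
  form-at-zero {zero}  M = refl
  form-at-zero {suc n} M = trans (+-congˡ (form-at-zero (λ i j → M (suc i) (suc j))))
    (solve 2 (λ a r → a :* (𝟘 :* 𝟘) :+ r :* ((𝟙 :+ 𝟙) :* 𝟘) :+ 𝟘 := 𝟘) refl (M zero zero) ((M zero ∘ suc) ∙ const 0#))

  lipschitz-∙ : ∀ {N n} {F : Fin n → Vector Carrier N → Carrier} (c : Vector Carrier n) →
    (∀ j → Lipschitz (F j)) → Lipschitz (λ x → (λ j → F j x) ∙ c)
  lipschitz-∙ {n = zero}  c F-lip = lipschitz-const 0#
  lipschitz-∙ {n = suc n} c F-lip =
    lipschitz-+ (lipschitz-scale (c zero) (F-lip zero)) (lipschitz-∙ (c ∘ suc) (F-lip ∘ suc))

  -- For fixed `c` the form is linear in the matrix entries. This is what makes positive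
  -- semidefiniteness a closed condition.
  lipschitz-form : ∀ {N n} {F : Fin n → Fin n → Vector Carrier N → Carrier} (c : Vector Carrier n) →
    (∀ i j → Lipschitz (F i j)) → Lipschitz (λ x → form (λ i j → F i j x) c)
  lipschitz-form {n = zero}  c F-lip = lipschitz-const 0#
  lipschitz-form {n = suc n} c F-lip = lipschitz-+
    (lipschitz-+ (lipschitz-scale (c zero * c zero) (F-lip zero zero))
      (lipschitz-scale (2# * c zero) (lipschitz-∙ (c ∘ suc) (F-lip zero ∘ suc))))
    (lipschitz-form (c ∘ suc) (λ i j → F-lip (suc i) (suc j)))

  PositiveSemidefinite : ∀ {n} → Matrix n → Set
  PositiveSemidefinite M = ∀ c → Nonneg (form M c)

  gram : ∀ {n d} → (Fin n → Vector Carrier d) → Matrix n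
  gram p i j = p i ∙ p j

  -- Induction on the dimension: each coordinate of the vectors contributes a rank-one term, whose
  -- form is a square.
  gram-positiveSemidefinite : ∀ {n d} (p : Fin n → Vector Carrier d) → PositiveSemidefinite (gram p)
  gram-positiveSemidefinite {d = zero}  p c = ≈⇒≤ (sym (form-zero c))
  gram-positiveSemidefinite {d = suc d} p c = ≤-respʳ (sym (trans
      (form-cong c (λ i j → solve 3 (λ a b g → a :* b :+ g := g :+ 𝟙 :* a :* b) refl (p i zero) (p j zero) (gram (λ i → p i ∘ suc) i j)))
      (form-rank-one (gram (λ i → p i ∘ suc)) 1# (λ i → p i zero) c)))
    (gram-positiveSemidefinite (λ i → p i ∘ suc) c ⊕ 0≤1 ⊗ square-nonneg _)

  -- Gaussian elimination (Cholesky): if the corner entry a vanishes, so does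
  -- the first row; otherwise the Schur complement is again positive semidefinite.
  positiveSemidefinite⇒gram : ∀ {n} (M : Matrix n) → (∀ i j → M i j ≈ M j i) → PositiveSemidefinite M →
    Σ[ p ∈ (Fin n → Vector Carrier n) ] (∀ i j → gram p i j ≈ M i j)
  positiveSemidefinite⇒gram {zero}  M M-sym psd = (λ ()) , λ ()
  positiveSemidefinite⇒gram {suc n} M M-sym psd with em {M zero zero ≈ 0#}
  ... | yes a≈0 = p , p-gram
    where
    a = M zero zero
    r = M zero ∘ suc
    M′ : Matrix n
    M′ i j = M (suc i) (suc j)

    psd′ : PositiveSemidefinite M′
    psd′ c = ≤-respʳ (solve 3 (λ a r q → a :* (𝟘 :* 𝟘) :+ r :* ((𝟙 :+ 𝟙) :* 𝟘) :+ q := q) refl a (r ∙ c) (form M′ c)) (psd (0# ∷ c))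

    r∙r≤0 : r ∙ r ≤ 0#
    r∙r≤0 = decidable-stable em λ ρ>0 →
      let
        ρ = r ∙ r
        q = form M′ r
        -- As `a` vanishes, the form at `x ∷ r` is `2 ρ x + q`. This `x` makes it `- q - 2`, which
        -- is negative because `q` is nonnegative.
        x = - (q + 1#) * ρ ⁻¹
        ρx : x * ρ ≈ - (q + 1#)
        ρx = trans (*-assoc _ _ _) (trans (*-congˡ (⁻¹-inverseˡ ρ (positive⇒≉0 ρ>0))) (*-identityʳ _))
        value : form M (x ∷ r) ≈ - q - 2#
        value = begin
          a * (x * x) + ρ * (2# * x) + q   ≈⟨ +-congʳ (+-congʳ (*-congʳ a≈0)) ⟩
          0# * (x * x) + ρ * (2# * x) + q  ≈⟨ solve 3 (λ x ρ q → 𝟘 :* (x :* x) :+ ρ :* ((𝟙 :+ 𝟙) :* x) :+ q := (𝟙 :+ 𝟙) :* (x :* ρ) :+ q) refl x ρ q ⟩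
          2# * (x * ρ) + q                 ≈⟨ +-congʳ (*-congˡ ρx) ⟩
          2# * - (q + 1#) + q              ≈⟨ solve 1 (λ q → (𝟙 :+ 𝟙) :* (:- (q :+ 𝟙)) :+ q := :- q :- (𝟙 :+ 𝟙)) refl q ⟩
          - q - 2#                         ∎
      in positive-1 (by-difference (≤-respʳ value (psd (x ∷ r)) ⊕ psd′ r ⊕ 0≤1)
        (solve 1 (λ q → 𝟙 :+ (:- q :- (𝟙 :+ 𝟙) :+ q :+ 𝟙) := 𝟘) refl q))
      where open ≈-Reasoning

    r≈0 : ∀ j → r j ≈ 0#
    r≈0 = ∙-definite r r∙r≤0

    rest = positiveSemidefinite⇒gram M′ (λ i j → M-sym (suc i) (suc j)) psd′

    p : Fin (suc n) → Vector Carrier (suc n)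
    p zero    = const 0#
    p (suc i) = 0# ∷ proj₁ rest i

    p-gram : ∀ i j → gram p i j ≈ M i j
    p-gram zero    zero    = trans (∙-zeroˡ (p zero)) (sym a≈0)
    p-gram zero    (suc j) = trans (∙-zeroˡ (p (suc j))) (sym (r≈0 j))
    p-gram (suc i) zero    = trans (∙-zeroʳ (p (suc i))) (sym (trans (M-sym (suc i) zero) (r≈0 i)))
    p-gram (suc i) (suc j) = trans (+-congʳ (zeroˡ 0#)) (trans (+-identityˡ _) (proj₂ rest i j))

  ... | no a≉0 = p , p-gram
    where
    a = M zero zero
    r = M zero ∘ suc
    M′ : Matrix n
    M′ i j = M (suc i) (suc j)

    0≤a : Nonneg a
    0≤a = ≤-respʳ (trans
        (+-cong (+-congˡ (*-congʳ (∙-zeroʳ r))) (form-at-zero M′))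
        (solve 1 (λ a → a :* (𝟙 :* 𝟙) :+ 𝟘 :* ((𝟙 :+ 𝟙) :* 𝟙) :+ 𝟘 := a) refl a))
      (psd (1# ∷ const 0#))

    root = square-root 0≤a
    ρ = proj₁ root
    ρ≉0 : ¬ ρ ≈ 0#
    ρ≉0 ρ≈0 = a≉0 (trans (sym (proj₂ root)) (trans (*-congʳ ρ≈0) (zeroˡ ρ)))
    w = ρ ⁻¹

    ρw≈1 : ρ * w ≈ 1#
    ρw≈1 = ⁻¹-inverseʳ ρ ρ≉0

    aww≈1 : a * (w * w) ≈ 1#
    aww≈1 = begin
      a * (w * w)        ≈⟨ *-congʳ (proj₂ root) ⟨
      ρ * ρ * (w * w)    ≈⟨ solve 2 (λ ρ w → ρ :* ρ :* (w :* w) := (ρ :* w) :* (ρ :* w)) refl ρ w ⟩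
      ρ * w * (ρ * w)    ≈⟨ *-cong ρw≈1 ρw≈1 ⟩
      1# * 1#            ≈⟨ *-identityˡ 1# ⟩
      1#                 ∎
      where open ≈-Reasoning

    schur : Matrix n
    schur i j = M′ i j + - (w * w) * r i * r j

    schur-sym : ∀ i j → schur i j ≈ schur j i
    schur-sym i j = +-cong (M-sym (suc i) (suc j))
      (solve 3 (λ m x y → m :* x :* y := m :* y :* x) refl (- (w * w)) (r i) (r j))

    schur-psd : PositiveSemidefinite schur
    schur-psd c = ≤-respʳ complete (psd (c₀ ∷ c))
      where
      open ≈-Reasoning
      β = r ∙ c
      q = form M′ c
      -- With `w * w` the inverse of `a`, this is the first coordinate that minimises the form;
      -- completing the square leaves the form of the Schur complement.
      c₀ = - (w * w) * β
      complete : form M (c₀ ∷ c) ≈ form schur c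
      complete = begin
        a * (c₀ * c₀) + β * (2# * c₀) + q
          ≈⟨ solve 4 (λ a w β q → a :* (((:- (w :* w)) :* β) :* ((:- (w :* w)) :* β)) :+ β :* ((𝟙 :+ 𝟙) :* ((:- (w :* w)) :* β)) :+ q
              := a :* (w :* w) :* (w :* w :* (β :* β)) :- (𝟙 :+ 𝟙) :* (w :* w :* (β :* β)) :+ q) refl a w β q ⟩
        a * (w * w) * (w * w * (β * β)) - 2# * (w * w * (β * β)) + q
          ≈⟨ +-congʳ (+-congʳ (*-congʳ aww≈1)) ⟩
        1# * (w * w * (β * β)) - 2# * (w * w * (β * β)) + q
          ≈⟨ solve 3 (λ w β q → 𝟙 :* (w :* w :* (β :* β)) :- (𝟙 :+ 𝟙) :* (w :* w :* (β :* β)) :+ q := q :+ (:- (w :* w)) :* (β :* β)) refl w β q ⟩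
        q + - (w * w) * (β * β)
          ≈⟨ form-rank-one M′ (- (w * w)) r c ⟨
        form schur c ∎

    rest = positiveSemidefinite⇒gram schur schur-sym schur-psd

    p : Fin (suc n) → Vector Carrier (suc n)
    p zero    = ρ ∷ const 0#
    p (suc i) = (r i * w) ∷ proj₁ rest i

    first-row : ∀ j → gram p zero (suc j) ≈ r j
    first-row j = begin
      ρ * (r j * w) + const 0# ∙ proj₁ rest j  ≈⟨ +-congˡ (∙-zeroˡ (proj₁ rest j)) ⟩
      ρ * (r j * w) + 0#                       ≈⟨ solve 3 (λ ρ x w → ρ :* (x :* w) :+ 𝟘 := x :* (ρ :* w)) refl ρ (r j) w ⟩
      r j * (ρ * w)                            ≈⟨ *-congˡ ρw≈1 ⟩
      r j * 1#                                 ≈⟨ *-identityʳ _ ⟩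
      r j                                      ∎
      where open ≈-Reasoning

    p-gram : ∀ i j → gram p i j ≈ M i j
    p-gram zero    zero    = trans (+-congˡ (∙-zeroˡ {n} (const 0#))) (trans (+-identityʳ _) (proj₂ root))
    p-gram zero    (suc j) = first-row j
    p-gram (suc i) zero    = trans (∙-comm (p (suc i)) (p zero)) (trans (first-row i) (M-sym zero (suc i)))
    p-gram (suc i) (suc j) = trans (+-congˡ (proj₂ rest i j))
      (solve 4 (λ x y w m → x :* w :* (y :* w) :+ (m :+ (:- (w :* w)) :* x :* y) := m) refl (r i) (r j) w (M′ i j))

-- A matrix with constant negative off-diagonal entries

module SimplexMatrix (em : ExcludedMiddle 0ℓ) (ℝ : CompleteOrderedField) where
  open OrderedField em ℝ
  open QuadraticForm em ℝ

  -- A multiple of the identity matrix, defined by the same recursion as `form` so that the two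
  -- unfold together.
  scalar : ∀ {n} → Carrier → Matrix n
  scalar m zero    zero    = m
  scalar m zero    (suc j) = 0#
  scalar m (suc i) zero    = 0#
  scalar m (suc i) (suc j) = scalar m i j

  scalar-diagonal : ∀ {n} m (i : Fin n) → scalar m i i ≡ m
  scalar-diagonal m zero    = ≡.refl
  scalar-diagonal m (suc i) = scalar-diagonal m i

  scalar-off-diagonal : ∀ {n} m {i j : Fin n} → ¬ i ≡ j → scalar m i j ≡ 0#
  scalar-off-diagonal m {zero}  {zero}  i≢j = ⊥-elim (i≢j ≡.refl)
  scalar-off-diagonal m {zero}  {suc j} i≢j = ≡.refl
  scalar-off-diagonal m {suc i} {zero}  i≢j = ≡.refl
  scalar-off-diagonal m {suc i} {suc j} i≢j = scalar-off-diagonal m (i≢j ∘ ≡.cong suc)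

  form-scalar : ∀ {n} m c → form (scalar {n} m) c ≈ m * (c ∙ c)
  form-scalar {zero}  m c = sym (zeroʳ m)
  form-scalar {suc n} m c = trans (+-cong (+-congˡ (*-congʳ (∙-zeroˡ (c ∘ suc)))) (form-scalar m (c ∘ suc)))
    (solve 3 (λ m c x → m :* (c :* c) :+ 𝟘 :* ((𝟙 :+ 𝟙) :* c) :+ m :* x := m :* (c :* c :+ x)) refl m (c zero) ((c ∘ suc) ∙ (c ∘ suc)))

  pow2 : ℕ → Carrier
  pow2 zero    = 1#
  pow2 (suc n) = pow2 n + pow2 n

  1≤pow2 : ∀ n → 1# ≤ pow2 n
  1≤pow2 zero    = ≤-refl
  1≤pow2 (suc n) = ≤-trans (1≤pow2 n) (by-difference (≤-trans 0≤1 (1≤pow2 n)) refl)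

  -- A weak Cauchy–Schwarz inequality, enough here and free of division.
  sum-squared-≤ : ∀ {n} (c : Vector Carrier n) → const 1# ∙ c * (const 1# ∙ c) ≤ pow2 n * (c ∙ c)
  sum-squared-≤ {zero}  c = ≈⇒≤ (solve 0 (𝟘 :* 𝟘 := 𝟙 :* 𝟘) refl)
  sum-squared-≤ {suc n} c = bound (c zero) (const 1# ∙ (c ∘ suc)) ((c ∘ suc) ∙ (c ∘ suc)) (pow2 n)
    (sum-squared-≤ (c ∘ suc)) (1≤pow2 n)
    where
    -- This is `(x + s)² ≤ 2 x² + 2 s²`; its factor two is the doubling in `pow2`.
    bound : ∀ x s q P → s * s ≤ P * q → 1# ≤ P → (1# * x + s) * (1# * x + s) ≤ (P + P) * (x * x + q)
    bound x s q P ss≤Pq 1≤P = by-difference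
      (square-nonneg (x - s) ⊕ (difference ss≤Pq ⊕ difference ss≤Pq) ⊕ (difference 1≤P ⊕ difference 1≤P) ⊗ square-nonneg x)
      (solve 4 (λ x s q P → (𝟙 :* x :+ s) :* (𝟙 :* x :+ s)
          :+ ((x :- s) :* (x :- s) :+ ((P :* q :- s :* s) :+ (P :* q :- s :* s)) :+ ((P :- 𝟙) :+ (P :- 𝟙)) :* (x :* x))
          := (P :+ P) :* (x :* x :+ q)) refl x s q P)

  simplexParameter : ℕ → Carrier
  simplexParameter n = pow2 n ⁻¹

  positive-pow2 : ∀ n → Positive (pow2 n)
  positive-pow2 n = positive-≤ positive-1 (1≤pow2 n)

  simplexParameter>0 : ∀ n → Positive (simplexParameter n)
  simplexParameter>0 n = positive-⁻¹ (positive-pow2 n)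

  ⁻¹-≤1 : ∀ {u} → 1# ≤ u → u ⁻¹ ≤ 1#
  ⁻¹-≤1 1≤u = ⁻¹-≤-swap positive-1 (positive-≤ positive-1 1≤u) (≤-respˡ (sym 1⁻¹≈1) 1≤u)

  1-≤⁻¹ : ∀ {u} → Positive u → u ≤ 1# → 1# ≤ u ⁻¹
  1-≤⁻¹ {u} u>0 u≤1 = ≤-respˡ 1⁻¹≈1 (⁻¹-≤-swap (positive-⁻¹ u>0) positive-1 (≤-trans (≈⇒≤ (⁻¹-unique (⁻¹-inverseˡ u (positive⇒≉0 u>0)))) u≤1))

  -- With `I` the identity and `J` the all-ones matrix this is `(1 + s) I - s J`. The factors `1#`
  -- put it in the shape of `form-rank-one`.
  simplex : ∀ n → Matrix n
  simplex n i j = scalar (1# + s) i j + - s * 1# * 1#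
    where s = simplexParameter n

  simplex-diagonal : ∀ {n} (i : Fin n) → simplex n i i ≈ 1#
  simplex-diagonal {n} i = trans (+-congʳ (reflexive (scalar-diagonal _ i)))
    (solve 1 (λ s → 𝟙 :+ s :+ (:- s) :* 𝟙 :* 𝟙 := 𝟙) refl (simplexParameter n))

  simplex-off-diagonal : ∀ {n} {i j : Fin n} → ¬ i ≡ j → simplex n i j ≈ - simplexParameter n
  simplex-off-diagonal {n} i≢j = trans (+-congʳ (reflexive (scalar-off-diagonal _ i≢j)))
    (solve 1 (λ s → 𝟘 :+ (:- s) :* 𝟙 :* 𝟙 := :- s) refl (simplexParameter n))

  -- The form is `(1 + s) |c|² - s (Σ c)²`. Since `(Σ c)²` is at most `pow2 n * |c|²` and `s` is the
  -- inverse of `pow2 n`, the subtracted term is at most `|c|²`.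
  simplex-positiveSemidefinite : ∀ n → PositiveSemidefinite (simplex n)
  simplex-positiveSemidefinite n c = ≤-respʳ
    (sym (trans (form-rank-one (scalar (1# + s)) (- s) (const 1#) c) (+-congʳ (form-scalar (1# + s) c))))
    (nonneg (simplexParameter n) (pow2 n) (c ∙ c) (const 1# ∙ c * (const 1# ∙ c))
      (positive⇒nonneg (simplexParameter>0 n)) (⁻¹-inverseˡ _ (positive⇒≉0 (positive-pow2 n)))
      (∙-nonneg c) (sum-squared-≤ c))
    where
    s = simplexParameter n
    nonneg : ∀ s P q w → Nonneg s → s * P ≈ 1# → Nonneg q → w ≤ P * q → Nonneg ((1# + s) * q + - s * w)
    nonneg s P q w 0≤s sP≈1 0≤q w≤Pq = ≤-respʳ (begin
        s * (P * q - w) + s * q      ≈⟨ solve 4 (λ s P q w → s :* (P :* q :- w) :+ s :* q := (s :* P :+ s) :* q :+ (:- s) :* w) refl s P q w ⟩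
        (s * P + s) * q + - s * w    ≈⟨ +-congʳ (*-congʳ (+-congʳ sP≈1)) ⟩
        (1# + s) * q + - s * w       ∎)
      (0≤s ⊗ difference w≤Pq ⊕ 0≤s ⊗ 0≤q)
      where open ≈-Reasoning

-- Retractions of finite graphs

fold-shift : ∀ {A : Set} (z : A) s m → fold (s z) s m ≡ fold z s (suc m)
fold-shift z s m = ≡.trans (≡.sym (fold-+ z s m)) (≡.cong (fold z s) (ℕ.+-comm m 1))

-- Self-maps are encoded in `Fin (n ^ n)`, so two of the iterates with exponents from 0 to `n ^ n`
-- coincide. From exponent `a` on the iterates are periodic, and a positive multiple of the period
-- that is at least `a` gives an idempotent.
idempotent-iterate : ∀ {n} (f : Fin n → Fin n) →
  ∃[ m ] (∀ i → fold (fold i f (suc m)) f (suc m) ≡ fold i f (suc m))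
idempotent-iterate {n} f
  with pigeonhole (ℕ.n<1+n (n ℕ.^ n)) (λ a → funToFin (λ i → fold i f (toℕ a)))
-- The successor of this witness computes to `suc (toℕ a) * suc d`, the exponent in `idempotent`.
... | a , b , a<b , same = d ℕ.+ toℕ a ℕ.* suc d , idempotent
  where
  open ≡.≡-Reasoning
  -- One less than the period `b - a`, so that the period `suc d` is visibly nonzero.
  d = toℕ b ∸ suc (toℕ a)

  d+a : suc d ℕ.+ toℕ a ≡ toℕ b
  d+a = ≡.trans (≡.sym (ℕ.+-suc d (toℕ a))) (ℕ.m∸n+n≡m a<b)

  step : ∀ i → fold i f (suc d ℕ.+ toℕ a) ≡ fold i f (toℕ a)
  step i = begin
    fold i f (suc d ℕ.+ toℕ a)  ≡⟨ ≡.cong (fold i f) d+a ⟩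
    fold i f (toℕ b)            ≡⟨ finToFun-funToFin (λ i → fold i f (toℕ b)) i ⟨
    _                           ≡⟨ ≡.cong (λ c → finToFun c i) same ⟨
    _                           ≡⟨ finToFun-funToFin (λ i → fold i f (toℕ a)) i ⟩
    fold i f (toℕ a)            ∎

  periodic : ∀ k x i → fold i f (k ℕ.* suc d ℕ.+ (x ℕ.+ toℕ a)) ≡ fold i f (x ℕ.+ toℕ a)
  periodic zero    x i = ≡.refl
  periodic (suc k) x i = begin
    fold i f (suc d ℕ.+ k ℕ.* suc d ℕ.+ (x ℕ.+ toℕ a))      ≡⟨ ≡.cong (fold i f) (ℕ.+-assoc (suc d) (k ℕ.* suc d) _) ⟩
    fold i f (suc d ℕ.+ (k ℕ.* suc d ℕ.+ (x ℕ.+ toℕ a)))    ≡⟨ fold-+ i f (suc d) ⟩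
    fold (fold i f (k ℕ.* suc d ℕ.+ (x ℕ.+ toℕ a))) f (suc d) ≡⟨ ≡.cong (λ j → fold j f (suc d)) (periodic k x i) ⟩
    fold (fold i f (x ℕ.+ toℕ a)) f (suc d)                 ≡⟨ fold-+ i f (suc d) ⟨
    fold i f (suc d ℕ.+ (x ℕ.+ toℕ a))                      ≡⟨ ≡.cong (fold i f) shuffle ⟩
    fold i f (x ℕ.+ (suc d ℕ.+ toℕ a))                      ≡⟨ fold-+ i f x ⟩
    fold (fold i f (suc d ℕ.+ toℕ a)) f x                   ≡⟨ ≡.cong (λ j → fold j f x) (step i) ⟩
    fold (fold i f (toℕ a)) f x                             ≡⟨ fold-+ i f x ⟨
    fold i f (x ℕ.+ toℕ a)                                  ∎
    where
    shuffle : suc d ℕ.+ (x ℕ.+ toℕ a) ≡ x ℕ.+ (suc d ℕ.+ toℕ a)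
    shuffle = ≡.trans (≡.sym (ℕ.+-assoc (suc d) x _)) (≡.trans (≡.cong (ℕ._+ toℕ a) (ℕ.+-comm (suc d) x)) (ℕ.+-assoc x (suc d) _))

  -- The exponent M = (1 + a)(1 + d) is a multiple of the period 1 + d and at least a.
  idempotent : ∀ i → fold (fold i f (suc (toℕ a) ℕ.* suc d)) f (suc (toℕ a) ℕ.* suc d) ≡ fold i f (suc (toℕ a) ℕ.* suc d)
  idempotent i = begin
    fold (fold i f M) f M    ≡⟨ fold-+ i f M ⟨
    fold i f (M ℕ.+ M)       ≡⟨ ≡.cong (λ N → fold i f (M ℕ.+ N)) M≡x+a ⟩
    fold i f (M ℕ.+ (x ℕ.+ toℕ a)) ≡⟨ periodic (suc (toℕ a)) x i ⟩
    fold i f (x ℕ.+ toℕ a)   ≡⟨ ≡.cong (fold i f) M≡x+a ⟨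
    fold i f M               ∎
    where
    M = suc (toℕ a) ℕ.* suc d
    x = M ∸ toℕ a
    M≡x+a : M ≡ x ℕ.+ toℕ a
    M≡x+a = ≡.sym (ℕ.m∸n+n≡m (ℕ.≤-trans (ℕ.n≤1+n _) (ℕ.m≤m*n (suc (toℕ a)) (suc d))))

module Folding {n} (G : SimpleGraph n) where
  open SimpleGraph G

  iterate-endomorphism : ∀ {f} → IsEndomorphism G f → ∀ m → IsEndomorphism G (λ i → fold i f m)
  iterate-endomorphism f-endo zero    i~j = i~j
  iterate-endomorphism f-endo (suc m) i~j = f-endo (iterate-endomorphism f-endo m i~j)

  LocallyInjectiveMap : (Fin n → Fin n) → Set
  LocallyInjectiveMap f = ∀ i j k → ¬ i ≡ j → Adj i k → Adj j k → ¬ f i ≡ f j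

  -- The neighbours y and r y of a fixed point x have the same image, so the
  -- set of fixed points is closed under adjacency.
  locallyInjective-retraction-trivial : Connected G → ∀ {r} → IsEndomorphism G r →
    (∀ i → r (r i) ≡ r i) → LocallyInjectiveMap r → ∀ i → r i ≡ i
  locallyInjective-retraction-trivial connected {r} r-endo idempotent injective i =
    -- By idempotence `r i` is a fixed point, and connectedness supplies a walk from it to `i`.
    propagate (connected (r i) i) (idempotent i)
    where
    propagate : ∀ {x y} → Star Adj x y → r x ≡ x → r y ≡ y
    propagate Star.ε rx≡x = rx≡x
    propagate {x} (_◅_ {j = y} x~y path) rx≡x with r y Fin.≟ y
    ... | yes ry≡y = propagate path ry≡y
    ... | no  ry≢y = ⊥-elim (injective (r y) y x ry≢y
      (≡.subst (Adj (r y)) rx≡x (r-endo (symmetric x~y))) (symmetric x~y) (idempotent y))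

  -- The iterate `fᵐ` is a two-sided inverse of `f` and itself an endomorphism, so applying it to an
  -- edge between images recovers the original edge.
  iterate-identity⇒automorphism : ∀ {f} → IsEndomorphism G f → ∀ m → (∀ i → fold i f (suc m) ≡ i) → IsAutomorphism G f
  iterate-identity⇒automorphism {f} f-endo m fᵐ⁺¹≡id = f-endo , (injective , surjective) , reflecting
    where
    cancel : ∀ i → fold (f i) f m ≡ i
    cancel i = ≡.trans (fold-shift i f m) (fᵐ⁺¹≡id i)
    injective : ∀ {i j} → f i ≡ f j → i ≡ j
    injective {i} {j} fi≡fj = ≡.trans (≡.sym (cancel i)) (≡.trans (≡.cong (λ k → fold k f m) fi≡fj) (cancel j))
    surjective : ∀ j → ∃[ i ] (∀ {k} → k ≡ i → f k ≡ j)
    surjective j = fold j f m , λ { ≡.refl → fᵐ⁺¹≡id j }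
    reflecting : ∀ {i j} → Adj (f i) (f j) → Adj i j
    reflecting {i} {j} fi~fj = ≡.subst₂ Adj (cancel i) (cancel j) (iterate-endomorphism f-endo m fi~fj)

  locallyInjective-endomorphisms⇒core : Connected G →
    (∀ {f} → IsEndomorphism G f → LocallyInjectiveMap f) → IsCore G
  locallyInjective-endomorphisms⇒core connected injective f f-endo with idempotent-iterate f
  ... | m , idempotent = iterate-identity⇒automorphism f-endo m
    (locallyInjective-retraction-trivial connected r-endo idempotent (injective r-endo))
    where
    r-endo : IsEndomorphism G (λ i → fold i f (suc m))
    r-endo = iterate-endomorphism f-endo (suc m)

-- Optimal colorings

module OptimalColoring (em : ExcludedMiddle 0ℓ) (ℝ : CompleteOrderedField) {n} (G : SimpleGraph n) where
  open SimpleGraph G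
  open OrderedField em ℝ
  open Compactness em ℝ
  open QuadraticForm em ℝ
  open SimplexMatrix em ℝ

  -- Instantiated with ≤ for vector colorings and with ≈ for strict ones.
  record EdgeCondition : Set₁ where
    infix 4 _≼_
    field
      _≼_       : Carrier → Carrier → Set
      ≼-reflexive : ∀ {a b} → a ≈ b → a ≼ b
      ≼-resp-≈  : ∀ {a a′ b b′} → a ≈ a′ → b ≈ b′ → a ≼ b → a′ ≼ b′
      ≼-closed  : ∀ {N} {L M : Vector Carrier N → Carrier} → Lipschitz L → Lipschitz M → Closed (λ x → L x ≼ M x)

  module _ (condition : EdgeCondition) where
    open EdgeCondition condition

    Coloring : Carrier → ∀ {d} → (Fin n → Vector Carrier d) → Set
    Coloring t p = 2# ≤ t × (∀ i → p i ∙ p i ≈ 1#) × (∀ i j → Adj i j → p i ∙ p j ≼ - ((t - 1#) ⁻¹))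

    -- This positive lower bound on `τ` survives in limits, so `t = 1 + 1 / τ` makes sense at the
    -- maximiser.
    τ₀ : Carrier
    τ₀ = simplexParameter n

    -- τ stands for 1 / (t - 1): in terms of τ and the Gram matrix M every
    -- condition is linear, and the least t corresponds to the greatest τ.
    Feasible : Carrier → Matrix n → Set
    Feasible τ M =
      τ₀ ≤ τ × τ ≤ 1# ×
      (∀ i j → - 1# ≤ M i j) × (∀ i j → M i j ≤ 1#) ×
      (∀ i j → M i j ≈ M j i) × (∀ i → M i i ≈ 1#) ×
      PositiveSemidefinite M ×
      (∀ i j → Adj i j → M i j ≼ - τ)

    feasible-resp : ∀ {τ M M′} → (∀ i j → M i j ≈ M′ i j) → Feasible τ M → Feasible τ M′
    feasible-resp M≈M′ (lower , upper , M≥-1 , M≤1 , M-sym , diagonal , psd , edges) =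
      lower , upper ,
      (λ i j → ≤-respʳ (M≈M′ i j) (M≥-1 i j)) , (λ i j → ≤-respˡ (M≈M′ i j) (M≤1 i j)) ,
      (λ i j → trans (sym (M≈M′ i j)) (trans (M-sym i j) (M≈M′ j i))) ,
      (λ i → trans (sym (M≈M′ i i)) (diagonal i)) ,
      (λ c → ≤-respʳ (form-cong c M≈M′) (psd c)) ,
      (λ i j i~j → ≼-resp-≈ (M≈M′ i j) refl (edges i j i~j))

    -- All off-diagonal entries equal `- τ₀`, so the edge condition holds with equality, hence for
    -- either choice of `≼`.
    simplex-feasible : Feasible τ₀ (simplex n)
    simplex-feasible =
      ≤-refl , τ₀≤1 , (λ i j → proj₁ (bounds i j)) , (λ i j → proj₂ (bounds i j)) ,
      symmetry , simplex-diagonal , simplex-positiveSemidefinite n ,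
      λ i j i~j → ≼-reflexive (simplex-off-diagonal (λ i≡j → loopless i≡j i~j))
      where
      0≤τ₀ : Nonneg τ₀
      0≤τ₀ = positive⇒nonneg (simplexParameter>0 n)
      τ₀≤1 : τ₀ ≤ 1#
      τ₀≤1 = ⁻¹-≤1 (1≤pow2 n)
      bounds : ∀ i j → - 1# ≤ simplex n i j × simplex n i j ≤ 1#
      bounds i j with i Fin.≟ j
      ... | yes ≡.refl = ≤-respʳ (sym (simplex-diagonal i)) (by-difference (0≤1 ⊕ 0≤1) (solve 0 (:- 𝟙 :+ (𝟙 :+ 𝟙) := 𝟙) refl)) ,
                         ≈⇒≤ (simplex-diagonal i)
      ... | no i≢j = ≤-respʳ (sym (simplex-off-diagonal i≢j)) (neg-mono-≤ τ₀≤1) ,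
                     ≤-respˡ (sym (simplex-off-diagonal i≢j)) (by-difference (0≤1 ⊕ 0≤τ₀) (solve 1 (λ s → :- s :+ (𝟙 :+ s) := 𝟙) refl τ₀))
      symmetry : ∀ i j → simplex n i j ≈ simplex n j i
      symmetry i j with i Fin.≟ j
      ... | yes ≡.refl = refl
      ... | no i≢j = trans (simplex-off-diagonal i≢j) (sym (simplex-off-diagonal (i≢j ∘ ≡.sym)))

    -- Coordinate zero is reserved for `τ`, the quantity to be maximised; the matrix entries fill
    -- the remaining coordinates.
    matrixPart : Vector Carrier (suc (n ℕ.* n)) → Matrix n
    matrixPart x i j = x (suc (combine i j))

    pack : Carrier → Matrix n → Vector Carrier (suc (n ℕ.* n))
    pack τ M = τ ∷ (uncurry M ∘ remQuot n)

    FeasiblePoint : Vector Carrier (suc (n ℕ.* n)) → Set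
    FeasiblePoint x = Feasible (x zero) (matrixPart x)

    pack-feasible : ∀ {τ M} → Feasible τ M → FeasiblePoint (pack τ M)
    pack-feasible {τ} {M} = feasible-resp λ i j → reflexive (≡.cong (uncurry M) (≡.sym (remQuot-combine i j)))

    -- Each condition relates two Lipschitz functions of the point; positive semidefiniteness is the
    -- intersection of one such condition for every `c`.
    feasible-closed : Closed FeasiblePoint
    feasible-closed =
      closed-∩ (closed-≤ (lipschitz-const τ₀) τ-lip) (closed-∩ (closed-≤ τ-lip (lipschitz-const 1#))
      (closed-∩ (closed-∀ λ i → closed-∀ λ j → closed-≤ (lipschitz-const (- 1#)) (entry-lip i j))
      (closed-∩ (closed-∀ λ i → closed-∀ λ j → closed-≤ (entry-lip i j) (lipschitz-const 1#))
      (closed-∩ (closed-∀ λ i → closed-∀ λ j → closed-≈ (entry-lip i j) (entry-lip j i))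
      (closed-∩ (closed-∀ λ i → closed-≈ (entry-lip i i) (lipschitz-const 1#))
      (closed-∩ (closed-∀ λ c → closed-≤ (lipschitz-const 0#) (lipschitz-form c entry-lip))
      (closed-∀ λ i → closed-∀ λ j → closed-∀ λ _ → ≼-closed (entry-lip i j) (lipschitz-neg τ-lip))))))))
      where
      τ-lip : Lipschitz (λ x → x zero)
      τ-lip = lipschitz-coordinate zero
      entry-lip : ∀ i j → Lipschitz (λ x → matrixPart x i j)
      entry-lip i j = lipschitz-coordinate (suc (combine i j))

    feasible-bounded : BoundedBy 1# FeasiblePoint
    feasible-bounded {x} (lower , upper , _) zero =
      by-difference (0≤1 ⊕ ≤-trans (positive⇒nonneg (simplexParameter>0 n)) lower)
        (solve 1 (λ τ → :- 𝟙 :+ (𝟙 :+ τ) := τ) refl (x zero)) ,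
      upper
    feasible-bounded {x} (_ , _ , M≥-1 , M≤1 , _) (suc k) = ≡.subst (λ l → - 1# ≤ x (suc l) × x (suc l) ≤ 1#)
      (combine-remQuot {n} n k) (M≥-1 _ _ , M≤1 _ _)

    coloring⇒1≤t-1 : ∀ {t} → 2# ≤ t → 1# ≤ t - 1#
    coloring⇒1≤t-1 {t} 2≤t = by-difference (difference 2≤t) (solve 1 (λ t → 𝟙 :+ (t :- (𝟙 :+ 𝟙)) := t :- 𝟙) refl t)

    gram-feasible : ∀ {t d} (p : Fin n → Vector Carrier d) → Coloring t p →
      τ₀ ≤ (t - 1#) ⁻¹ → Feasible ((t - 1#) ⁻¹) (gram p)
    gram-feasible p (2≤t , unit , edge) lower =
      lower , ⁻¹-≤1 (coloring⇒1≤t-1 2≤t) ,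
      (λ i j → proj₁ (unit⇒∙-bounded {u = p i} {p j} (unit i) (unit j))) ,
      (λ i j → proj₂ (unit⇒∙-bounded {u = p i} {p j} (unit i) (unit j))) ,
      (λ i j → ∙-comm (p i) (p j)) , unit , gram-positiveSemidefinite p , edge

    [t-1]⁻¹≈τ : ∀ {τ} → Positive τ → (1# + τ ⁻¹ - 1#) ⁻¹ ≈ τ
    [t-1]⁻¹≈τ {τ} τ>0 = ⁻¹-unique (trans (solve 2 (λ u v → (𝟙 :+ v :- 𝟙) :* u := v :* u) refl τ (τ ⁻¹)) (⁻¹-inverseˡ τ (positive⇒≉0 τ>0)))

    -- Passing from `t` to `1 / (t - 1)` reverses the order, so the greatest `τ` yields the least
    -- `t`.
    t-least : ∀ {s τ} → Positive τ → 2# ≤ s → (s - 1#) ⁻¹ ≤ τ → 1# + τ ⁻¹ ≤ s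
    t-least {s} τ>0 2≤s σ≤τ = ≤-respʳ (solve 1 (λ s → 𝟙 :+ (s :- 𝟙) := s) refl s)
      (+-mono-≤ ≤-refl (⁻¹-≤-swap (positive-≤ positive-1 (coloring⇒1≤t-1 2≤s)) τ>0 σ≤τ))

    ≤-by-cases : ∀ {a b c} → a ≤ c → (a ≤ b → b ≤ c) → b ≤ c
    ≤-by-cases {a} {b} a≤c b≤c with total a b
    ... | inj₁ a≤b = b≤c a≤b
    ... | inj₂ b≤a = ≤-trans b≤a a≤c

    -- Maximise `τ` over the feasible points, factor the maximising matrix as a Gram matrix, and set
    -- `t = 1 + 1 / τ`. Competitors of every dimension are covered, since they enter only through
    -- their Gram matrices.
    optimal-coloring : ∃[ t ] Σ[ p ∈ (Fin n → Vector Carrier n) ]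
      (Coloring t p × (∀ s {e} (q : Fin n → Vector Carrier e) → Coloring s q → t ≤ s))
    optimal-coloring = attained (maximise-first FeasiblePoint 1# feasible-closed feasible-bounded
      (pack τ₀ (simplex n) , pack-feasible simplex-feasible))
      where
      attained : ∃[ x ] (FeasiblePoint x × ∀ y → FeasiblePoint y → y zero ≤ x zero) →
        ∃[ t ] Σ[ p ∈ (Fin n → Vector Carrier n) ]
          (Coloring t p × (∀ s {e} (q : Fin n → Vector Carrier e) → Coloring s q → t ≤ s))
      attained (x , (lower , upper , _ , _ , M-sym , diagonal , psd , edges) , maximal) =
        1# + x zero ⁻¹ , proj₁ factor ,
        -- The bound `2# ≤ t` comes from the constraint `τ ≤ 1#`.
        (+-mono-≤ ≤-refl (1-≤⁻¹ τ>0 upper) ,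
          (λ i → trans (proj₂ factor i i) (diagonal i)) ,
          (λ i j i~j → ≼-resp-≈ (sym (proj₂ factor i j)) (-‿cong (sym ([t-1]⁻¹≈τ τ>0))) (edges i j i~j))) ,
        -- If `1 / (s - 1)` is below `τ₀`, the Gram matrix of `q` need not be feasible, but then the
        -- comparison follows from `τ₀ ≤ x zero`.
        λ s q q-coloring → t-least τ>0 (proj₁ q-coloring) (≤-by-cases lower λ τ₀≤σ →
          maximal (pack ((s - 1#) ⁻¹) (gram q)) (pack-feasible {M = gram q} (gram-feasible q q-coloring τ₀≤σ)))
        where
        factor : Σ[ p ∈ (Fin n → Vector Carrier n) ] (∀ i j → gram p i j ≈ matrixPart x i j)
        factor = positiveSemidefinite⇒gram (matrixPart x) M-sym psd
        τ>0 : Positive (x zero)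
        τ>0 = positive-≤ (simplexParameter>0 n) lower

  nonstrict strict : EdgeCondition
  nonstrict = record
    { _≼_         = _≤_
    ; ≼-reflexive = ≈⇒≤
    ; ≼-resp-≈    = λ a≈a′ b≈b′ a≤b → ≤-respʳ b≈b′ (≤-respˡ a≈a′ a≤b)
    ; ≼-closed    = closed-≤
    }
  strict = record
    { _≼_         = _≈_
    ; ≼-reflexive = id
    ; ≼-resp-≈    = λ a≈a′ b≈b′ a≈b → trans (sym a≈a′) (trans a≈b b≈b′)
    ; ≼-closed    = closed-≈
    }

  fromVectorColoring : ∀ {t d} {p : Fin n → Vector Carrier d} → IsVectorColoring ℝ G t p → Coloring nonstrict t p
  fromVectorColoring coloring = 2≤t , unit , λ i j → edge
    where open IsVectorColoring coloring

  fromStrictVectorColoring : ∀ {t d} {p : Fin n → Vector Carrier d} → IsStrictVectorColoring ℝ G t p → Coloring strict t p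
  fromStrictVectorColoring coloring = 2≤t , unit , λ i j → IsStrictVectorColoring.strict coloring
    where open IsVectorColoring (IsStrictVectorColoring.isVectorColoring coloring)

  toVectorColoring : ∀ {t d} {p : Fin n → Vector Carrier d} → Coloring nonstrict t p → IsVectorColoring ℝ G t p
  toVectorColoring (2≤t , unit , edge) = record { 2≤t = 2≤t ; unit = unit ; edge = edge _ _ }

  toStrictVectorColoring : ∀ {t d} {p : Fin n → Vector Carrier d} → Coloring strict t p → IsStrictVectorColoring ℝ G t p
  toStrictVectorColoring (2≤t , unit , edge) = record
    { isVectorColoring = record { 2≤t = 2≤t ; unit = unit ; edge = λ i~j → ≈⇒≤ (edge _ _ i~j) }
    ; strict           = edge _ _
    }

  optimalVectorColoring : Σ[ p ∈ (Fin n → Vector Carrier n) ] IsOptimalVectorColoring ℝ G p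
  optimalVectorColoring =
    let t , p , coloring , least = optimal-coloring nonstrict in
    p , t ,
    ((n , p , toVectorColoring coloring) , λ { s (e , q , q-coloring) → least s q (fromVectorColoring q-coloring) }) ,
    toVectorColoring coloring

  optimalStrictVectorColoring : Σ[ p ∈ (Fin n → Vector Carrier n) ] IsOptimalStrictVectorColoring ℝ G p
  optimalStrictVectorColoring =
    let t , p , coloring , least = optimal-coloring strict in
    p , t ,
    ((n , p , toStrictVectorColoring coloring) , λ { s (e , q , q-coloring) → least s q (fromStrictVectorColoring q-coloring) }) ,
    toStrictVectorColoring coloring

  vectorColoring-∘ : ∀ {t d} {p : Fin n → Vector Carrier d} {f} → IsEndomorphism G f →
    IsVectorColoring ℝ G t p → IsVectorColoring ℝ G t (p ∘ f)
  vectorColoring-∘ f-endo coloring = record { 2≤t = 2≤t ; unit = λ i → unit _ ; edge = λ i~j → edge (f-endo i~j) }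
    where open IsVectorColoring coloring

  strictVectorColoring-∘ : ∀ {t d} {p : Fin n → Vector Carrier d} {f} → IsEndomorphism G f →
    IsStrictVectorColoring ℝ G t p → IsStrictVectorColoring ℝ G t (p ∘ f)
  strictVectorColoring-∘ f-endo coloring = record
    { isVectorColoring = vectorColoring-∘ f-endo (IsStrictVectorColoring.isVectorColoring coloring)
    ; strict           = λ i~j → IsStrictVectorColoring.strict coloring (f-endo i~j)
    }

  open Folding G

  -- Vertices identified by `f` receive the same vector under `p ∘ f`, so local injectivity of
  -- `p ∘ f` passes to `f`.
  locallyInjective-∘⇒core : Connected G → ∀ {d} (p : Fin n → Vector Carrier d) →
    (∀ {f} → IsEndomorphism G f → LocallyInjective ℝ G (p ∘ f)) → IsCore G
  locallyInjective-∘⇒core connected p injective = locallyInjective-endomorphisms⇒core connected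
    λ f-endo i j k i≢j i~k j~k fi≡fj → injective f-endo i j k i≢j i~k j~k
      λ l → reflexive (≡.cong (λ v → p v l) fi≡fj)

theorem4p3 : ExcludedMiddle 0ℓ →
    (ℝ : CompleteOrderedField) →
    (n : ℕ) (G : SimpleGraph n) →
    Connected G →
    ((∀ d (p : Assignment ℝ G d) →
    IsOptimalVectorColoring ℝ G p → LocallyInjective ℝ G p) →
    IsCore G)
    ×
    ((∀ d (p : Assignment ℝ G d) →
    IsOptimalStrictVectorColoring ℝ G p → LocallyInjective ℝ G p) →
    IsCore G)
    ×
    (UniquelyVectorColorable ℝ G →
    (Σ[ d ∈ ℕ ] Σ[ p ∈ Assignment ℝ G d ]
    (IsOptimalVectorColoring ℝ G p × LocallyInjective ℝ G p)) →
    IsCore G)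
theorem4p3 em ℝ n G connected = vector , strictVector , unique
  where
  open OptimalColoring em ℝ G
  open QuadraticForm em ℝ using (same-gram⇒sameVector)

  vector : (∀ d (p : Assignment ℝ G d) → IsOptimalVectorColoring ℝ G p → LocallyInjective ℝ G p) → IsCore G
  vector injective =
    let p , t , minimal , coloring = optimalVectorColoring in
    locallyInjective-∘⇒core connected p λ {f} f-endo →
    injective n (p ∘ f) (t , minimal , vectorColoring-∘ f-endo coloring)

  strictVector : (∀ d (p : Assignment ℝ G d) → IsOptimalStrictVectorColoring ℝ G p → LocallyInjective ℝ G p) → IsCore G
  strictVector injective =
    let p , t , minimal , coloring = optimalStrictVectorColoring in
    locallyInjective-∘⇒core connected p λ {f} f-endo →
    injective n (p ∘ f) (t , minimal , strictVectorColoring-∘ f-endo coloring)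

  unique : UniquelyVectorColorable ℝ G →
    (Σ[ d ∈ ℕ ] Σ[ p ∈ Assignment ℝ G d ] (IsOptimalVectorColoring ℝ G p × LocallyInjective ℝ G p)) → IsCore G
  unique same-gram (d , p , (t , minimal , coloring) , injective) = locallyInjective-∘⇒core connected p
    λ {f} f-endo i j k i≢j i~k j~k pfi≈pfj →
      let gram≈ = same-gram p (p ∘ f) (t , minimal , coloring) (t , minimal , vectorColoring-∘ f-endo coloring) in
      injective i j k i≢j i~k j~k (same-gram⇒sameVector (gram≈ i i) (gram≈ i j) (gram≈ j j) pfi≈pfj)
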